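{- There exists a stable set $S \subseteq \mathbb{N}$ with natural density $d(S) = \frac{1}{2}$ (in particular $S$ has positive lower density) such that \[ S \cap (S+1) \cap (S+2) = \emptyset . \]
   Context: For $A \subseteq \mathbb{N}$, the natural density is $d(A) = \lim_{x\to\infty} \frac{|A \cap [1,x]|}{x}$ when the limit exists; the lower density $\underline{d}(A)$ is the corresponding $\liminf$. For $h \in \mathbb{Z}$, $S + h = \{ s + h : s \in S\}$. A set $S \subseteq \mathbb{N}$ is called stable if for every prime $p$, \[ d\big(\{ n \in \mathbb{N} : \mathbb{1}_{n \in S} \neq \mathbb{1}_{pn \in S} \}\big) = 0, \] i.e. for every prime $p$, $n \in S$ if and only if $pn \in S$ for all $n$ outside a set of density $0$. -}

module Defs where

open import Data.Nat using (ℕ; zero; suc; _*_; _≥_)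
open import Data.Nat.Primality using (Prime)
open import Data.Bool using (Bool; true; false; if_then_else_; _xor_)
open import Data.Integer using (+_)
open import Data.Rational using (ℚ; _/_; _-_; ∣_∣; _<_; 0ℚ; ½)
open import Data.Product using (∃; _×_)
open import Relation.Binary.PropositionalEquality using (_≡_)
open import Relation.Nullary using (¬_)

-- A subset of ℕ is represented by its (decidable) indicator function.
-- Index 0 is present for convenience; subsets of ℕ = {1,2,...} are those with A 0 ≡ false.
NSet : Set
NSet = ℕ → Bool

count : NSet → ℕ → ℕ
count A zero = zero
count A (suc x) = (if A (suc x) then 1 else 0) Data.Nat.+ count A x

HasDensity : NSet → ℚ → Set
HasDensity A δ =
  (ε : ℚ) → 0ℚ < ε → ∃ λ N → (m : ℕ) → m ≥ N →
    ∣ ((+ count A (suc m)) / suc m) - δ ∣ < ε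

Stable : NSet → Set
Stable S = (p : ℕ) → Prime p → HasDensity (λ n → S n xor S (p * n)) 0ℚ

-- S ∩ (S+1) ∩ (S+2) = ∅ : no n with n, n+1, n+2 all in S
-- (n ∈ S+1 ∩ S+2 ∩ S iff n-2, n-1, n ∈ S).
NoThreeConsecutive : NSet → Set
NoThreeConsecutive S =
  (n : ℕ) → ¬ (S n ≡ true × S (suc n) ≡ true × S (suc (suc n)) ≡ true)

{-# OPTIONS --safe #-}
module Submission where

-- Let u be the completely multiplicative function with u(3) = 1 and u(n) = ±1 for n ≡ ±1 mod 3.
-- It takes both values on any three consecutive integers, so if σ = ±1 depends only on the size
-- of n, then S = {n : u(n) = σ(n) = σ(n+1) = σ(n+2)} contains no three consecutive integers; S has
-- density 1/2 by partial summation as σ changes rarely, and it is stable once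
-- σ(pn) = u(p) σ(n) for almost all n, for every prime p.
--
-- For the primes up to K such a σ is built on the cycle ℤ/Q of cells of ⌊Q log₂ n⌋ mod Q. The
-- integers ∏ p^a with a in a large box occupy distinct cells by unique factorisation, and a greedy
-- choice of translates of this box tiles the cycle so that few cells lie near the edge of their
-- tile. If a cell is moved to the marker of its tile by multiplication by d, put σ = u(d), with a
-- further sign u(2) for every turn round the cycle. As K grows, the solutions for consecutive K
-- are exchanged one tile at a time, one tile per dyadic block.

open import Defs
open import Data.Bool using (false)
open import Data.Rational using (½)
open import Data.Product using (∃; _×_)
open import Relation.Binary.PropositionalEquality using (_≡_)

-- A sign with boundedly many changes per dyadic block cannot serve all primes: `u` takes opposite
-- values at 3k+1 and 3k+2, so σ would have to separate (3k+1)m from (3k+2)m for almost all m,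
-- although their ratio is as close to 1 as one likes. The number of changes has to grow; partial
-- summation tolerates this because the partial sums of `u` are only logarithmic, and about s
-- changes are allowed in the block at 2^s.
--
-- For finitely many primes, σ(pn) = u(p) σ(n) asks for `u` to be a coboundary of commuting
-- translations of a cycle, and the tiling is a finite Rokhlin tower: the equation can fail only
-- near the edges of the tiles.
--
-- Passing to the next stage all at once would spoil the equation whenever n lies before the switch
-- and pn after it, a positive proportion of the integers of that size. Away from the edges n and pn
-- belong to the same tile, so when whole tiles are exchanged they still follow the same stage, and
-- only the few small tiles exchanged between the two blocks are lost.

module Arithmetic where

  open import Data.Bool using (Bool; true; false; not; _xor_; if_then_else_)
  open import Data.List using (List; []; _∷_; _++_; length; map; filter; upTo; cartesianProductWith)
  open import Data.List.Membership.Propositional using (_∈_; lose)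
  open import Data.List.Membership.Propositional.Properties using (∈-cartesianProductWith⁺; ∈-cartesianProductWith⁻; ∈-filter⁺; ∈-filter⁻; ∈-upTo⁺)
  open import Data.List.Relation.Unary.All as All using (All; []; _∷_)
  open import Data.List.Relation.Unary.AllPairs using ([]; _∷_)
  open import Data.List.Relation.Unary.Any as Any using (Any; any?; here; there)
  open import Data.List.Relation.Unary.Unique.Propositional using (Unique)
  open import Data.List.Relation.Unary.Unique.Propositional.Properties using (cartesianProductWith⁺; filter⁺; upTo⁺)
  open import Data.Nat
  open import Data.Nat.DivMod
  open import Data.Nat.Divisibility using (_∣_; ∣1⇒≡1; m∣m*n)
  open import Data.Nat.Induction using (<-wellFounded; Acc; acc)
  open import Data.Nat.Logarithm
  open import Data.Nat.Logarithm.Core using (⌊log2⌋)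
  open import Data.Nat.Primality using (Prime; prime?; prime[2]; euclidsLemma; prime⇒irreducible; prime⇒nonZero; ¬prime[1])
  open import Data.Nat.Properties
  open import Data.Nat.Tactic.RingSolver using (solve-∀)
  open import Data.Product using (∃; _×_; _,_; proj₁; proj₂)
  open import Data.Sum using (_⊎_; inj₁; inj₂)
  open import Data.Vec using (Vec; []; _∷_; replicate)
  open import Data.Vec.Properties using (∷-injective)
  open import Function using (_∘_)
  open import Relation.Binary.Definitions using (Tri; tri<; tri≈; tri>)
  open import Relation.Binary.PropositionalEquality
  open import Relation.Nullary using (¬_; ¬?; Dec; yes; no; contradiction)
  open import Relation.Nullary.Decidable using (_×-dec_)

  -- Finite sums of natural numbers over lists

  private variable
    A B C : Set

  𝟙 : Bool → ℕ
  𝟙 b = if b then 1 else 0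

  δ : ℕ → ℕ → ℕ
  δ m n with m ≟ n
  ... | yes _ = 1
  ... | no _  = 0

  ∑ : List A → (A → ℕ) → ℕ
  ∑ []       f = 0
  ∑ (x ∷ xs) f = f x + ∑ xs f

  𝟙≤1 : ∀ b → 𝟙 b ≤ 1
  𝟙≤1 true  = ≤-refl
  𝟙≤1 false = z≤n

  δ-refl : ∀ n → δ n n ≡ 1
  δ-refl n with n ≟ n
  ... | yes _   = refl
  ... | no n≢n = contradiction refl n≢n

  δ-≢ : ∀ {m n} → m ≢ n → δ m n ≡ 0
  δ-≢ {m} {n} m≢n with m ≟ n
  ... | yes m≡n = contradiction m≡n m≢n
  ... | no _    = refl

  δ>0 : ∀ {m n} → 0 < δ m n → m ≡ n
  δ>0 {m} {n} p with m ≟ n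
  ... | yes m≡n = m≡n

  δ≤1 : ∀ m n → δ m n ≤ 1
  δ≤1 m n with m ≟ n
  ... | yes _ = ≤-refl
  ... | no _  = z≤n

  ∑-mono : ∀ (xs : List A) {f g : A → ℕ} → (∀ x → x ∈ xs → f x ≤ g x) → ∑ xs f ≤ ∑ xs g
  ∑-mono []       h = z≤n
  ∑-mono (x ∷ xs) h = +-mono-≤ (h x (here refl)) (∑-mono xs (λ y y∈ → h y (there y∈)))

  ∑-cong : ∀ (xs : List A) {f g : A → ℕ} → (∀ x → x ∈ xs → f x ≡ g x) → ∑ xs f ≡ ∑ xs g
  ∑-cong []       h = refl
  ∑-cong (x ∷ xs) h = cong₂ _+_ (h x (here refl)) (∑-cong xs (λ y y∈ → h y (there y∈)))

  ∑-distrib-+ : ∀ (xs : List A) (f g : A → ℕ) → ∑ xs (λ x → f x + g x) ≡ ∑ xs f + ∑ xs g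
  ∑-distrib-+ []       f g = refl
  ∑-distrib-+ (x ∷ xs) f g = trans (cong (f x + g x +_) (∑-distrib-+ xs f g)) (shuffle (f x) (g x) _ _)
    where
    shuffle : ∀ a b c d → a + b + (c + d) ≡ a + c + (b + d)
    shuffle = solve-∀

  ∑-*ˡ : ∀ (xs : List A) c (f : A → ℕ) → ∑ xs (λ x → c * f x) ≡ c * ∑ xs f
  ∑-*ˡ []       c f = sym (*-zeroʳ c)
  ∑-*ˡ (x ∷ xs) c f = trans (cong (c * f x +_) (∑-*ˡ xs c f)) (sym (*-distribˡ-+ c (f x) _))

  ∑-*ʳ : ∀ (xs : List A) c (f : A → ℕ) → ∑ xs (λ x → f x * c) ≡ ∑ xs f * c
  ∑-*ʳ xs c f = trans (∑-cong xs (λ x _ → *-comm (f x) c)) (trans (∑-*ˡ xs c f) (*-comm c _))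

  ∑-const : ∀ (xs : List A) c → ∑ xs (λ _ → c) ≡ length xs * c
  ∑-const []       c = refl
  ∑-const (x ∷ xs) c = cong (c +_) (∑-const xs c)

  ∑-bound : ∀ (xs : List A) {f : A → ℕ} c → (∀ x → x ∈ xs → f x ≤ c) → ∑ xs f ≤ length xs * c
  ∑-bound xs c h = ≤-trans (∑-mono xs h) (≤-reflexive (∑-const xs c))

  ∑-zero : ∀ (xs : List A) → ∑ xs (λ _ → 0) ≡ 0
  ∑-zero []       = refl
  ∑-zero (x ∷ xs) = ∑-zero xs

  ∑-swap : ∀ (xs : List A) (ys : List B) (f : A → B → ℕ) →
           ∑ xs (λ x → ∑ ys (f x)) ≡ ∑ ys (λ y → ∑ xs (λ x → f x y))
  ∑-swap []       ys f = sym (∑-zero ys)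
  ∑-swap (x ∷ xs) ys f = trans (cong (∑ ys (f x) +_) (∑-swap xs ys f)) (sym (∑-distrib-+ ys (f x) _))

  ∑-++ : ∀ (xs ys : List A) (f : A → ℕ) → ∑ (xs ++ ys) f ≡ ∑ xs f + ∑ ys f
  ∑-++ []       ys f = refl
  ∑-++ (x ∷ xs) ys f = trans (cong (f x +_) (∑-++ xs ys f)) (sym (+-assoc (f x) _ _))

  ∑-term : ∀ (xs : List A) (f : A → ℕ) {x} → x ∈ xs → f x ≤ ∑ xs f
  ∑-term (x ∷ xs) f (here refl) = m≤m+n _ _
  ∑-term (x ∷ xs) f (there x∈)  = ≤-trans (∑-term xs f x∈) (m≤n+m _ _)

  ∑>0 : ∀ (xs : List A) (f : A → ℕ) → 0 < ∑ xs f → ∃ λ x → x ∈ xs × 0 < f x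
  ∑>0 (x ∷ xs) f p with f x in eq
  ... | suc _ = x , here refl , subst (0 <_) (sym eq) (s≤s z≤n)
  ... | zero with ∑>0 xs f p
  ...   | y , y∈ , q = y , there y∈ , q

  ∑≡0 : ∀ (xs : List A) (f : A → ℕ) → ∑ xs f ≡ 0 → ∀ {x} → x ∈ xs → f x ≡ 0
  ∑≡0 xs f eq x∈ = n≤0⇒n≡0 (≤-trans (∑-term xs f x∈) (≤-reflexive eq))

  -- Turns injectivity into a count: if `f` is the indicator of a condition that determines its
  -- solution, at most one entry contributes.
  ∑-unique : ∀ {xs : List A} {f : A → ℕ} → Unique xs → (∀ x → f x ≤ 1) →
             (∀ {x y} → x ∈ xs → y ∈ xs → 0 < f x → 0 < f y → x ≡ y) → ∑ xs f ≤ 1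
  ∑-unique [] _ _ = z≤n
  ∑-unique {xs = x ∷ xs} {f} (x∉ ∷ u) f≤1 inj with f x in eq
  ... | zero  = ∑-unique u f≤1 (λ a b → inj (there a) (there b))
  ... | suc m with ∑ xs f in eq′
  ...   | zero  = subst (_≤ 1) (trans eq (sym (+-identityʳ _))) (f≤1 x)
  ...   | suc s with ∑>0 xs f (subst (0 <_) (sym eq′) (s≤s z≤n))
  ...     | y , y∈ , q = contradiction
              (inj (here refl) (there y∈) (subst (0 <_) (sym eq) (s≤s z≤n)) q) (All.lookup x∉ y∈)

  -- The averaging step of the greedy choice. The demand `0 < g x` excludes entries where both
  -- functions vanish; it makes every choice of a marker cover something new.
  ∑-select : ∀ (xs : List A) (f g : A → ℕ) → ∑ xs f ≤ ∑ xs g → 0 < ∑ xs g →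
             ∃ λ x → x ∈ xs × f x ≤ g x × 0 < g x
  ∑-select {A} xs f g le pos with search xs
    where
    -- The second alternative is what summation gives when no entry qualifies: `∑ ys g ≤ ∑ ys f`,
    -- strictly unless `∑ ys g` vanishes.
    search : ∀ ys → (∃ λ x → x ∈ ys × f x ≤ g x × 0 < g x) ⊎
                    (∑ ys g ≤ ∑ ys f × (∑ ys g ≡ 0 ⊎ ∑ ys g < ∑ ys f))
    search [] = inj₂ (z≤n , inj₁ refl)
    search (y ∷ ys) with search ys
    ... | inj₁ (x , x∈ , p) = inj₁ (x , there x∈ , p)
    ... | inj₂ (weak , alt) with f y ≤? g y
    ...   | no f≰g = inj₂ (<⇒≤ lt , inj₂ lt)
      where lt = +-mono-<-≤ (≰⇒> f≰g) weak
    ...   | yes f≤g with 1 ≤? g y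
    ...     | yes g>0 = inj₁ (y , here refl , f≤g , g>0)
    ...     | no g≯0 rewrite n<1⇒n≡0 (≰⇒> g≯0) | n≤0⇒n≡0 f≤g = inj₂ (weak , alt)
  ... | inj₁ r = r
  ... | inj₂ (_ , inj₁ z) = contradiction (subst (0 <_) z pos) (λ ())
  ... | inj₂ (_ , inj₂ lt) = contradiction (<-≤-trans lt le) (<-irrefl refl)

  range : ℕ → ℕ → List ℕ
  range a zero    = []
  range a (suc n) = a ∷ range (suc a) n

  length-range : ∀ a n → length (range a n) ≡ n
  length-range a zero    = refl
  length-range a (suc n) = cong suc (length-range (suc a) n)

  ∈-range⁻ : ∀ {a n x} → x ∈ range a n → a ≤ x × x < a + n
  ∈-range⁻ {a} {suc n} (here refl) = ≤-refl , m<m+n a (s≤s z≤n)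
  ∈-range⁻ {a} {suc n} {x} (there x∈) with ∈-range⁻ {suc a} {n} x∈
  ... | lo , hi = <⇒≤ lo , subst (x <_) (sym (+-suc a n)) hi

  ∈-range⁺ : ∀ {a n x} → a ≤ x → x < a + n → x ∈ range a n
  ∈-range⁺ {a} {zero} lo hi = contradiction (subst (_<_ _) (+-identityʳ a) hi) (≤⇒≯ lo)
  ∈-range⁺ {a} {suc n} {x} lo hi with a ≟ x
  ... | yes refl = here refl
  ... | no a≢x   = there (∈-range⁺ (≤∧≢⇒< lo a≢x) (subst (x <_) (+-suc a n) hi))

  range-unique : ∀ a n → Unique (range a n)
  range-unique a zero    = []
  range-unique a (suc n) =
    All.tabulate (λ x∈ → <⇒≢ (proj₁ (∈-range⁻ x∈))) ∷ range-unique (suc a) n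

  range-++ : ∀ a m n → range a (m + n) ≡ range a m ++ range (a + m) n
  range-++ a zero    n rewrite +-identityʳ a = refl
  range-++ a (suc m) n rewrite +-suc a m = cong (a ∷_) (range-++ (suc a) m n)

  ∑-range-+ : ∀ a m n (f : ℕ → ℕ) → ∑ (range a (m + n)) f ≡ ∑ (range a m) f + ∑ (range (a + m) n) f
  ∑-range-+ a m n f = trans (cong (λ r → ∑ r f) (range-++ a m n)) (∑-++ (range a m) _ f)

  ∑-range-suc : ∀ a n (f : ℕ → ℕ) → ∑ (range a (suc n)) f ≡ ∑ (range a n) f + f (a + n)
  ∑-range-suc a n f = trans (cong (λ k → ∑ (range a k) f) (+-comm 1 n))
    (trans (∑-range-+ a n 1 f) (cong (∑ (range a n) f +_) (+-identityʳ _)))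

  ∑-range-mono : ∀ a {m n} (f : ℕ → ℕ) → m ≤ n → ∑ (range a m) f ≤ ∑ (range a n) f
  ∑-range-mono a {m} {n} f m≤n = ≤-trans (m≤m+n _ _) (≤-reflexive
    (trans (sym (∑-range-+ a m (n ∸ m) f)) (cong (λ k → ∑ (range a k) f) (m+[n∸m]≡n m≤n))))

  ∑-δˡ : ∀ {z n} → z < n → (f : ℕ → ℕ) → ∑ (range 0 n) (λ y → δ z y * f y) ≡ f z
  ∑-δˡ {z} {n} z<n f = go 0 n z≤n z<n
    where
    go : ∀ a n → a ≤ z → z < a + n → ∑ (range a n) (λ y → δ z y * f y) ≡ f z
    miss : ∀ a n → z < a → ∑ (range a n) (λ y → δ z y * f y) ≡ 0
    miss a zero    z<a = refl
    miss a (suc n) z<a rewrite δ-≢ (<⇒≢ z<a) = miss (suc a) n (m<n⇒m<1+n z<a)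
    go a zero a≤z z<a+0 = contradiction (subst (z <_) (+-identityʳ a) z<a+0) (≤⇒≯ a≤z)
    go a (suc n) a≤z z<a+n with z ≟ a
    ... | yes refl rewrite miss (suc a) n ≤-refl = trans (+-identityʳ _) (*-identityˡ _)
    ... | no z≢a = go (suc a) n (≤∧≢⇒< a≤z (z≢a ∘ sym)) (subst (z <_) (+-suc a n) z<a+n)

  -- Greedy tilings of a cycle

  module Tiling {E : Set} (Q : ℕ) .{{_ : NonZero Q}} (shape : List E) (off : E → ℕ) (edge : E → Bool)
    (e₀ : E) (distinct : Unique shape)
    (off-injective : ∀ x {e e′} → e ∈ shape → e′ ∈ shape →
                     (x + off e) % Q ≡ (x + off e′) % Q → e ≡ e′)
    (R : ℕ) (few-edges : R * ∑ shape (λ e → 𝟙 (edge e)) ≤ length shape)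
    (inhabited : 0 < length shape)
    where

    cells : List ℕ
    cells = range 0 Q

    -- If the cell `x` occupies position `e` of a tile, this is the marker of the tile. The tile of
    -- a marker `y` consists of the cells `x` with `at x e ≡ y` for some `e` in `shape`.
    at : ℕ → E → ℕ
    at x e = (x + off e) % Q

    hit? : ∀ y x → Dec (Any (λ e → at x e ≡ y) shape)
    hit? y x = any? (λ e → at x e ≟ y) shape

    -- The translates may overlap; a cell belongs to the earliest marker in the list that reaches
    -- it, and its position there is returned. The default `e₀` is for cells that no marker reaches.
    tile : List ℕ → ℕ → E
    tile []       x = e₀
    tile (y ∷ ys) x with hit? y x
    ... | yes h = Any.lookup h
    ... | no _  = tile ys x

    Covers : List ℕ → ℕ → Set
    Covers ys x = Any (λ y → Any (λ e → at x e ≡ y) shape) ys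

    lookup-hit : ∀ {y x es} (h : Any (λ e → at x e ≡ y) es) →
                 Any.lookup h ∈ es × at x (Any.lookup h) ≡ y
    lookup-hit (here p)  = here refl , p
    lookup-hit (there h) with lookup-hit h
    ... | m , p = there m , p

    tile∈shape : ∀ ys {x} → Covers ys x → tile ys x ∈ shape
    tile∈shape (y ∷ ys) {x} c with hit? y x
    ... | yes h = proj₁ (lookup-hit h)
    tile∈shape (y ∷ ys) (here h)  | no ¬h = contradiction h ¬h
    tile∈shape (y ∷ ys) (there c) | no _  = tile∈shape ys c

    -- The marker that `x` chooses is reached from an inner position, hence by `x′` as well, so `x′`
    -- cannot choose a later one; by symmetry both choose the same.
    tile-consistent : ∀ ys {x x′} → Covers ys x → Covers ys x′ →
      (∀ {e} → e ∈ shape → edge e ≡ false → ∃ λ e′ → e′ ∈ shape × at x′ e′ ≡ at x e) →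
      (∀ {e} → e ∈ shape → edge e ≡ false → ∃ λ e′ → e′ ∈ shape × at x e′ ≡ at x′ e) →
      edge (tile ys x) ≡ false → edge (tile ys x′) ≡ false →
      at x (tile ys x) ≡ at x′ (tile ys x′)
    tile-consistent (y ∷ ys) {x} {x′} c c′ fwd bwd i i′ with hit? y x | hit? y x′
    ... | yes h | yes h′ = trans (proj₂ (lookup-hit h)) (sym (proj₂ (lookup-hit h′)))
    ... | yes h | no ¬h′ with lookup-hit h
    ...   | m , p with fwd m i
    ...     | e′ , m′ , q = contradiction (lose m′ (trans q p)) ¬h′
    tile-consistent (y ∷ ys) {x} {x′} c c′ fwd bwd i i′ | no ¬h | yes h′ with lookup-hit h′
    ...   | m , p with bwd m i′
    ...     | e′ , m′ , q = contradiction (lose m′ (trans q p)) ¬h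
    tile-consistent (y ∷ ys) (here h) c′ fwd bwd i i′ | no ¬h | no ¬h′ = contradiction h ¬h
    tile-consistent (y ∷ ys) (there c) (here h′) fwd bwd i i′ | no ¬h | no ¬h′ = contradiction h′ ¬h′
    tile-consistent (y ∷ ys) (there c) (there c′) fwd bwd i i′ | no ¬h | no ¬h′ =
      tile-consistent ys c c′ fwd bwd i i′

    size : (ℕ → Bool) → ℕ
    size U = ∑ cells (λ x → 𝟙 (U x))

    edges : (ℕ → Bool) → List ℕ → ℕ
    edges U ys = ∑ cells (λ x → 𝟙 (U x) * 𝟙 (edge (tile ys x)))

    missed : (ℕ → Bool) → ℕ → ℕ → Bool
    missed U y x with hit? y x
    ... | yes _ = false
    ... | no _  = U x

    -- With `w` constantly 1 this counts the cells of `U` that the marker `y` reaches; with `w` the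
    -- indicator of `edge`, those that it reaches at an edge position.
    weight : (ℕ → Bool) → (E → ℕ) → ℕ → ℕ
    weight U w y = ∑ shape (λ e → ∑ cells (λ x → δ (at x e) y * (𝟙 (U x) * w e)))

    -- Every pair of a cell and a position belongs to exactly one marker.
    weight-total : ∀ U w → ∑ cells (weight U w) ≡ ∑ shape w * size U
    weight-total U w = begin
      ∑ cells (weight U w)
        ≡⟨ ∑-swap cells shape _ ⟩
      ∑ shape (λ e → ∑ cells (λ y → ∑ cells (λ x → δ (at x e) y * (𝟙 (U x) * w e))))
        ≡⟨ ∑-cong shape (λ e _ → trans (∑-swap cells cells _)
             (∑-cong cells (λ x _ → ∑-δˡ (m%n<n (x + off e) Q) (λ _ → 𝟙 (U x) * w e)))) ⟩
      ∑ shape (λ e → ∑ cells (λ x → 𝟙 (U x) * w e))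
        ≡⟨ ∑-cong shape (λ e _ → trans (∑-*ʳ cells (w e) _) (*-comm (size U) (w e))) ⟩
      ∑ shape (λ e → w e * size U)
        ≡⟨ ∑-*ʳ shape (size U) w ⟩
      ∑ shape w * size U ∎
      where open ≡-Reasoning

    weight-swap : ∀ U w y →
      weight U w y ≡ ∑ cells (λ x → 𝟙 (U x) * ∑ shape (λ e → δ (at x e) y * w e))
    weight-swap U w y = trans (∑-swap shape cells _) (∑-cong cells λ x _ →
      trans (∑-cong shape (λ e _ → rearrange (δ (at x e) y) (𝟙 (U x)) (w e))) (∑-*ˡ shape (𝟙 (U x)) _))
      where
      rearrange : ∀ a b c → a * (b * c) ≡ b * (a * c)
      rearrange = solve-∀

    hits≤1 : ∀ x y → ∑ shape (λ e → δ (at x e) y * 1) ≤ 1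
    hits≤1 x y = ≤-trans (≤-reflexive (∑-cong shape (λ e _ → *-identityʳ _)))
      (∑-unique distinct (λ e → δ≤1 _ y)
        (λ m m′ p p′ → off-injective x m m′ (trans (δ>0 p) (sym (δ>0 p′)))))

    -- By `off-injective` a marker reaches a cell in at most one position, so the weight counts no
    -- covered cell twice.
    weight+missed : ∀ U y → weight U (λ _ → 1) y + size (missed U y) ≤ size U
    weight+missed U y = begin
      weight U (λ _ → 1) y + size (missed U y)
        ≡⟨ cong (_+ size (missed U y)) (weight-swap U (λ _ → 1) y) ⟩
      ∑ cells (λ x → 𝟙 (U x) * ∑ shape (λ e → δ (at x e) y * 1)) + size (missed U y)
        ≡⟨ ∑-distrib-+ cells _ _ ⟨
      ∑ cells (λ x → 𝟙 (U x) * ∑ shape (λ e → δ (at x e) y * 1) + 𝟙 (missed U y x))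
        ≤⟨ ∑-mono cells (λ x _ → pointwise x) ⟩
      size U ∎
      where
      open ≤-Reasoning
      pointwise : ∀ x → 𝟙 (U x) * ∑ shape (λ e → δ (at x e) y * 1) + 𝟙 (missed U y x) ≤ 𝟙 (U x)
      pointwise x with hit? y x
      ... | yes h = ≤-trans (≤-reflexive (+-identityʳ _))
                      (≤-trans (*-monoʳ-≤ (𝟙 (U x)) (hits≤1 x y)) (≤-reflexive (*-identityʳ _)))
      ... | no ¬h = ≤-reflexive (cong (_+ 𝟙 (U x)) (trans (cong (𝟙 (U x) *_) none) (*-zeroʳ (𝟙 (U x)))))
        where
        none : ∑ shape (λ e → δ (at x e) y * 1) ≡ 0
        none = trans (∑-cong shape (λ e m → cong (_* 1) (δ-≢ (λ p → ¬h (lose m p))))) (∑-zero shape)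

    edges-∷ : ∀ U y ys → edges U (y ∷ ys) ≤ weight U (λ e → 𝟙 (edge e)) y + edges (missed U y) ys
    edges-∷ U y ys = begin
      edges U (y ∷ ys)
        ≤⟨ ∑-mono cells (λ x _ → pointwise x) ⟩
      ∑ cells (λ x → 𝟙 (U x) * ∑ shape (λ e → δ (at x e) y * 𝟙 (edge e))
                     + 𝟙 (missed U y x) * 𝟙 (edge (tile ys x)))
        ≡⟨ ∑-distrib-+ cells _ _ ⟩
      ∑ cells (λ x → 𝟙 (U x) * ∑ shape (λ e → δ (at x e) y * 𝟙 (edge e))) + edges (missed U y) ys
        ≡⟨ cong (_+ edges (missed U y) ys) (weight-swap U _ y) ⟨
      weight U (λ e → 𝟙 (edge e)) y + edges (missed U y) ys ∎
      where
      open ≤-Reasoning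
      pointwise : ∀ x → 𝟙 (U x) * 𝟙 (edge (tile (y ∷ ys) x)) ≤
        𝟙 (U x) * ∑ shape (λ e → δ (at x e) y * 𝟙 (edge e)) + 𝟙 (missed U y x) * 𝟙 (edge (tile ys x))
      pointwise x with hit? y x
      ... | no _  = m≤n+m _ _
      ... | yes h with lookup-hit h
      ...   | m , p = ≤-trans (*-monoʳ-≤ (𝟙 (U x)) (≤-trans (≤-reflexive one)
                        (∑-term shape (λ e → δ (at x e) y * 𝟙 (edge e)) m))) (m≤m+n _ _)
        where
        one : 𝟙 (edge (Any.lookup h)) ≡ δ (at x (Any.lookup h)) y * 𝟙 (edge (Any.lookup h))
        one rewrite p | δ-refl y = sym (*-identityˡ _)

    -- Averaging over all marker positions y finds one whose newly covered cells contain
    -- few edge positions; iterating on the uncovered cells keeps this ratio throughout.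
    greedy : ∀ fuel U → size U ≤ fuel →
      ∃ λ ys → (∀ {x} → x < Q → U x ≡ true → Covers ys x) × R * edges U ys ≤ size U
    greedy fuel U le with size U in eq
    ... | zero = [] , (λ x<Q Ux → contradiction (trans (sym (cong 𝟙 Ux))
                        (∑≡0 cells (λ x → 𝟙 (U x)) eq (∈-range⁺ z≤n x<Q))) (λ ()))
               , ≤-trans (*-monoʳ-≤ R (≤-trans (∑-mono cells (λ x _ → small x)) (≤-reflexive eq)))
                         (≤-reflexive (*-zeroʳ R))
      where
      small : ∀ x → 𝟙 (U x) * 𝟙 (edge e₀) ≤ 𝟙 (U x)
      small x = ≤-trans (*-monoʳ-≤ (𝟙 (U x)) (𝟙≤1 (edge e₀))) (≤-reflexive (*-identityʳ _))
    greedy zero U le | suc n = contradiction le λ ()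
    greedy (suc fuel) U le | suc n with ∑-select cells
        (λ y → R * weight U (λ e → 𝟙 (edge e)) y) (weight U (λ _ → 1)) total-le total-pos
      where
      open ≤-Reasoning
      total : ∑ cells (weight U (λ _ → 1)) ≡ length shape * size U
      total = trans (weight-total U (λ _ → 1))
        (cong (_* size U) (trans (∑-const shape 1) (*-identityʳ (length shape))))
      total-le : ∑ cells (λ y → R * weight U (λ e → 𝟙 (edge e)) y) ≤ ∑ cells (weight U (λ _ → 1))
      total-le = begin
        ∑ cells (λ y → R * weight U (λ e → 𝟙 (edge e)) y) ≡⟨ ∑-*ˡ cells R _ ⟩
        R * ∑ cells (weight U (λ e → 𝟙 (edge e)))         ≡⟨ cong (R *_) (weight-total U _) ⟩
        R * (∑ shape (λ e → 𝟙 (edge e)) * size U)         ≡⟨ *-assoc R _ _ ⟨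
        R * ∑ shape (λ e → 𝟙 (edge e)) * size U           ≤⟨ *-monoˡ-≤ (size U) few-edges ⟩
        length shape * size U                             ≡⟨ total ⟨
        ∑ cells (weight U (λ _ → 1))                      ∎
      total-pos : 0 < ∑ cells (weight U (λ _ → 1))
      total-pos = subst (0 <_) (sym total) (*-mono-≤ inhabited (subst (0 <_) (sym eq) (s≤s z≤n)))
    ... | y , _ , ratio , gain
      with greedy fuel (missed U y) (≤-pred (≤-trans (≤-trans (+-monoˡ-≤ _ gain) (weight+missed U y))
                                                     (subst (_≤ suc fuel) (sym eq) le)))
    ...   | ys , covers , bound = y ∷ ys , covers′ , bound′
      where
      covers′ : ∀ {x} → x < Q → U x ≡ true → Covers (y ∷ ys) x
      covers′ {x} x<Q Ux with hit? y x in h?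
      ... | yes h = here h
      ... | no _ = there (covers x<Q miss)
        where
        miss : missed U y x ≡ true
        miss rewrite h? = Ux
      open ≤-Reasoning
      bound′ : R * edges U (y ∷ ys) ≤ suc n
      bound′ = begin
        R * edges U (y ∷ ys)
          ≤⟨ *-monoʳ-≤ R (edges-∷ U y ys) ⟩
        R * (weight U (λ e → 𝟙 (edge e)) y + edges (missed U y) ys)
          ≡⟨ *-distribˡ-+ R _ _ ⟩
        R * weight U (λ e → 𝟙 (edge e)) y + R * edges (missed U y) ys
          ≤⟨ +-mono-≤ ratio bound ⟩
        weight U (λ _ → 1) y + size (missed U y)
          ≤⟨ weight+missed U y ⟩
        size U
          ≡⟨ eq ⟩
        suc n ∎

    Consistent : (ℕ → E) → Set
    Consistent el = ∀ {x x′} → x < Q → x′ < Q →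
      (∀ {e} → e ∈ shape → edge e ≡ false → ∃ λ e′ → e′ ∈ shape × at x′ e′ ≡ at x e) →
      (∀ {e} → e ∈ shape → edge e ≡ false → ∃ λ e′ → e′ ∈ shape × at x e′ ≡ at x′ e) →
      edge (el x) ≡ false → edge (el x′) ≡ false → at x (el x) ≡ at x′ (el x′)

    tiling : ∃ λ (el : ℕ → E) → (∀ {x} → x < Q → el x ∈ shape) × Consistent el ×
                                R * ∑ cells (λ x → 𝟙 (edge (el x))) ≤ Q
    tiling with greedy Q (λ _ → true) (≤-reflexive size-all)
      where
      size-all : size (λ _ → true) ≡ Q
      size-all = trans (∑-const cells 1) (trans (*-identityʳ _) (length-range 0 Q))
    ... | ys , covers , bound = tile ys , (λ x<Q → tile∈shape ys (covers x<Q refl))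
        , (λ x<Q x′<Q → tile-consistent ys (covers x<Q refl) (covers x′<Q refl)) , (begin
      R * ∑ cells (λ x → 𝟙 (edge (tile ys x)))     ≡⟨ cong (R *_) (∑-cong cells (λ x _ → *-identityˡ _)) ⟨
      R * ∑ cells (λ x → 1 * 𝟙 (edge (tile ys x))) ≤⟨ bound ⟩
      ∑ cells (λ _ → 1)                            ≡⟨ ∑-const cells 1 ⟩
      length cells * 1                             ≡⟨ *-identityʳ _ ⟩
      length cells                                 ≡⟨ length-range 0 Q ⟩
      Q                                            ∎)
      where open ≤-Reasoning

  -- Discretised logarithms

  ^>0 : ∀ m n → 0 < m → 0 < m ^ n
  ^>0 (suc m) n _ = m^n>0 (suc m) n

  ⌊n/2⌋-bounds : ∀ n → 2 * ⌊ n /2⌋ ≤ n × suc n ≤ 2 * suc ⌊ n /2⌋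
  ⌊n/2⌋-bounds zero = z≤n , s≤s z≤n
  ⌊n/2⌋-bounds (suc zero) = z≤n , s≤s (s≤s z≤n)
  ⌊n/2⌋-bounds (suc (suc n)) with ⌊n/2⌋-bounds n
  ... | lo , hi = subst (_≤ suc (suc n)) (sym (dbl ⌊ n /2⌋)) (s≤s (s≤s lo))
                , subst (suc (suc (suc n)) ≤_) (sym (dbl (suc ⌊ n /2⌋))) (s≤s (s≤s hi))
    where
    dbl : ∀ k → 2 * suc k ≡ suc (suc (2 * k))
    dbl = solve-∀

  2^⌊log₂n⌋-bounds : ∀ n → 2 ^ ⌊log₂ suc n ⌋ ≤ suc n × suc n < 2 ^ suc ⌊log₂ suc n ⌋
  2^⌊log₂n⌋-bounds n = go n (<-wellFounded (suc n))
    where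
    -- The induction follows the recursion that defines `⌊log2⌋`, whose second argument is an
    -- accessibility proof.
    go : ∀ n (ac : Acc _<_ (suc n)) → 2 ^ ⌊log2⌋ (suc n) ac ≤ suc n × suc n < 2 ^ suc (⌊log2⌋ (suc n) ac)
    go zero    ac = s≤s z≤n , s≤s (s≤s z≤n)
    go (suc n) (acc rs) with go ⌊ n /2⌋ (rs _) | ⌊n/2⌋-bounds (suc (suc n))
    ... | lo , hi | lo₂ , hi₂ = ≤-trans (*-monoʳ-≤ 2 lo) lo₂ , ≤-trans hi₂ (*-monoʳ-≤ 2 hi)

  2^⌊log₂n⌋≤n : ∀ {n} → 0 < n → 2 ^ ⌊log₂ n ⌋ ≤ n
  2^⌊log₂n⌋≤n {suc n} _ = proj₁ (2^⌊log₂n⌋-bounds n)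

  n<2^1+⌊log₂n⌋ : ∀ n → n < 2 ^ suc ⌊log₂ n ⌋
  n<2^1+⌊log₂n⌋ zero    = s≤s z≤n
  n<2^1+⌊log₂n⌋ (suc n) = proj₂ (2^⌊log₂n⌋-bounds n)

  2^k≤n⇒k≤⌊log₂n⌋ : ∀ {k n} → 2 ^ k ≤ n → k ≤ ⌊log₂ n ⌋
  2^k≤n⇒k≤⌊log₂n⌋ {k} {n} le = subst (_≤ ⌊log₂ n ⌋) (⌊log₂[2^n]⌋≡n k) (⌊log₂⌋-mono-≤ le)

  n<2^k⇒⌊log₂n⌋<k : ∀ {k n} → 0 < n → n < 2 ^ k → ⌊log₂ n ⌋ < k
  n<2^k⇒⌊log₂n⌋<k {k} {n} n>0 lt with k ≤? ⌊log₂ n ⌋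
  ... | yes k≤ = contradiction (<-≤-trans lt (≤-trans (^-monoʳ-≤ 2 k≤) (2^⌊log₂n⌋≤n n>0))) (<-irrefl refl)
  ... | no k≰  = ≰⇒> k≰

  ⌊log₂⌋-unique : ∀ {k n} → 2 ^ k ≤ n → n < 2 ^ suc k → ⌊log₂ n ⌋ ≡ k
  ⌊log₂⌋-unique {k} {n} lo hi =
    ≤-antisym (≤-pred (n<2^k⇒⌊log₂n⌋<k (≤-trans (^>0 2 k (s≤s z≤n)) lo) hi)) (2^k≤n⇒k≤⌊log₂n⌋ lo)

  ⌊log₂⌋-2^* : ∀ r {n} → 0 < n → ⌊log₂ (2 ^ r * n) ⌋ ≡ r + ⌊log₂ n ⌋
  ⌊log₂⌋-2^* r {n} n>0 = ⌊log₂⌋-unique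
    (≤-trans (≤-reflexive (^-distribˡ-+-* 2 r _)) (*-monoʳ-≤ (2 ^ r) (2^⌊log₂n⌋≤n n>0)))
    (<-≤-trans (*-monoʳ-< (2 ^ r) {{>-nonZero (^>0 2 r (s≤s z≤n))}} (n<2^1+⌊log₂n⌋ n))
      (≤-reflexive (trans (sym (^-distribˡ-+-* 2 r _)) (cong (2 ^_) (+-suc r _)))))

  ⌊log₂⌋-* : ∀ {m n} → 0 < m → 0 < n →
             ∃ λ η → η ≤ 1 × ⌊log₂ (m * n) ⌋ ≡ ⌊log₂ m ⌋ + ⌊log₂ n ⌋ + η
  ⌊log₂⌋-* {m} {n} m>0 n>0 = ⌊log₂ (m * n) ⌋ ∸ (⌊log₂ m ⌋ + ⌊log₂ n ⌋)
    , ≤-trans (∸-monoˡ-≤ (⌊log₂ m ⌋ + ⌊log₂ n ⌋) (≤-pred hi)) (≤-reflexive (m+n∸n≡m 1 (⌊log₂ m ⌋ + ⌊log₂ n ⌋)))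
    , sym (m+[n∸m]≡n lo)
    where
    lo : ⌊log₂ m ⌋ + ⌊log₂ n ⌋ ≤ ⌊log₂ (m * n) ⌋
    lo = 2^k≤n⇒k≤⌊log₂n⌋ (≤-trans (≤-reflexive (^-distribˡ-+-* 2 ⌊log₂ m ⌋ _))
           (*-mono-≤ (2^⌊log₂n⌋≤n m>0) (2^⌊log₂n⌋≤n n>0)))
    hi : ⌊log₂ (m * n) ⌋ < 2 + (⌊log₂ m ⌋ + ⌊log₂ n ⌋)
    hi = n<2^k⇒⌊log₂n⌋<k (*-mono-≤ m>0 n>0) (<-≤-trans
           (*-mono-< (n<2^1+⌊log₂n⌋ m) (n<2^1+⌊log₂n⌋ n))
           (≤-reflexive (trans (sym (^-distribˡ-+-* 2 (suc ⌊log₂ m ⌋) (suc ⌊log₂ n ⌋)))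
              (cong (2 ^_) (cong suc (+-suc ⌊log₂ m ⌋ _))))))

  -- Bernoulli's inequality for the k-th power of 1 + r/a, multiplied by `a ^ suc k`.
  bernoulli : ∀ a r k → (a + k * r) * a ^ k ≤ a * (a + r) ^ k
  bernoulli a r zero    = ≤-reflexive (cong (_* 1) (+-identityʳ a))
  bernoulli a r (suc k) = begin
    (a + suc k * r) * (a * a ^ k)       ≤⟨ m≤m+n _ (r * (k * r) * a ^ k) ⟩
    (a + suc k * r) * (a * a ^ k) + r * (k * r) * a ^ k ≡⟨ expand a r k (a ^ k) ⟩
    (a + r) * ((a + k * r) * a ^ k)     ≤⟨ *-monoʳ-≤ (a + r) (bernoulli a r k) ⟩
    (a + r) * (a * (a + r) ^ k)         ≡⟨ swap (a + r) a _ ⟩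
    a * ((a + r) * (a + r) ^ k)         ∎
    where
    open ≤-Reasoning
    expand : ∀ a r k p → (a + suc k * r) * (a * p) + r * (k * r) * p ≡ (a + r) * ((a + k * r) * p)
    expand = solve-∀
    swap : ∀ x y z → x * (y * z) ≡ y * (x * z)
    swap = solve-∀

  2*n^n≤[1+n]^n : ∀ {n} → 0 < n → 2 * n ^ n ≤ suc n ^ n
  2*n^n≤[1+n]^n {suc m} _ = *-cancelˡ-≤ n (begin
    n * (2 * n ^ n)         ≡⟨ rearrange n (n ^ n) ⟩
    (n + n * 1) * n ^ n     ≤⟨ bernoulli n 1 n ⟩
    n * (n + 1) ^ n         ≡⟨ cong (λ z → n * z ^ n) (+-comm n 1) ⟩
    n * suc n ^ n           ∎)
    where
    open ≤-Reasoning
    n = suc m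
    rearrange : ∀ n p → n * (2 * p) ≡ (n + n * 1) * p
    rearrange = solve-∀

  ^-distribʳ-* : ∀ k m n → (m * n) ^ k ≡ m ^ k * n ^ k
  ^-distribʳ-* zero    m n = refl
  ^-distribʳ-* (suc k) m n = trans (cong (m * n *_) (^-distribʳ-* k m n)) (shuffle m n _ _)
    where
    shuffle : ∀ a b c d → a * b * (c * d) ≡ a * c * (b * d)
    shuffle = solve-∀

  -- The m-th power of n/m is at least that of 1 + 1/m, hence at least 2. Among the k factors n/m
  -- there are q groups of m, and the remaining factors are at least 1.
  2^q*m^k≤n^k : ∀ {m n} q k → 0 < m → m < n → q * m ≤ k → 2 ^ q * m ^ k ≤ n ^ k
  2^q*m^k≤n^k {m} {n} q k m>0 m<n qm≤k = begin
    2 ^ q * m ^ k                               ≡⟨ cong (λ j → 2 ^ q * m ^ j) (sym split) ⟩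
    2 ^ q * m ^ (m * q + (k ∸ m * q))           ≡⟨ cong (2 ^ q *_) (^-distribˡ-+-* m (m * q) _) ⟩
    2 ^ q * (m ^ (m * q) * m ^ (k ∸ m * q))     ≡⟨ *-assoc (2 ^ q) _ _ ⟨
    2 ^ q * m ^ (m * q) * m ^ (k ∸ m * q)       ≡⟨ cong (λ z → 2 ^ q * z * m ^ (k ∸ m * q)) (^-*-assoc m m q) ⟨
    2 ^ q * (m ^ m) ^ q * m ^ (k ∸ m * q)       ≡⟨ cong (_* m ^ (k ∸ m * q)) (^-distribʳ-* q 2 (m ^ m)) ⟨
    (2 * m ^ m) ^ q * m ^ (k ∸ m * q)           ≤⟨ *-mono-≤ (^-monoˡ-≤ q (≤-trans (2*n^n≤[1+n]^n m>0) (^-monoˡ-≤ m m<n)))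
                                                            (^-monoˡ-≤ (k ∸ m * q) (<⇒≤ m<n)) ⟩
    (n ^ m) ^ q * n ^ (k ∸ m * q)               ≡⟨ cong (_* n ^ (k ∸ m * q)) (^-*-assoc n m q) ⟩
    n ^ (m * q) * n ^ (k ∸ m * q)               ≡⟨ ^-distribˡ-+-* n (m * q) _ ⟨
    n ^ (m * q + (k ∸ m * q))                   ≡⟨ cong (n ^_) split ⟩
    n ^ k                                       ∎
    where
    open ≤-Reasoning
    split : m * q + (k ∸ m * q) ≡ k
    split = m+[n∸m]≡n (≤-trans (≤-reflexive (*-comm m q)) qm≤k)

  -- ℓ n = ⌊Q log₂ n⌋ is a discretised logarithm in which doubling is an exact shift by Q.
  module Log (Q : ℕ) where

    ℓ : ℕ → ℕ
    ℓ n = ⌊log₂ (n ^ Q) ⌋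

    ℓ-mono : ∀ {m n} → m ≤ n → ℓ m ≤ ℓ n
    ℓ-mono m≤n = ⌊log₂⌋-mono-≤ (^-monoˡ-≤ Q m≤n)

    ℓ-2^* : ∀ r {n} → 0 < n → ℓ (2 ^ r * n) ≡ r * Q + ℓ n
    ℓ-2^* r {n} n>0 = trans (cong ⌊log₂_⌋ (trans (^-distribʳ-* Q (2 ^ r) n) (cong (_* n ^ Q) (^-*-assoc 2 r Q))))
      (⌊log₂⌋-2^* (r * Q) (^>0 n Q n>0))

    ℓ-* : ∀ {m n} → 0 < m → 0 < n → ∃ λ η → η ≤ 1 × ℓ (m * n) ≡ ℓ m + ℓ n + η
    ℓ-* {m} {n} m>0 n>0 rewrite ^-distribʳ-* Q m n = ⌊log₂⌋-* (^>0 m Q m>0) (^>0 n Q n>0)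

    -- Spreads small integers out: below Q/q, different integers have values of `ℓ` at distance at
    -- least q, which leaves room for a coordinate of length q between them.
    ℓ-gap : ∀ {m n} q → 0 < m → m < n → q * m ≤ Q → q + ℓ m ≤ ℓ n
    ℓ-gap {m} {n} q m>0 m<n qm≤Q = subst (_≤ ℓ n) (⌊log₂⌋-2^* q (^>0 m Q m>0))
      (⌊log₂⌋-mono-≤ (2^q*m^k≤n^k q Q m>0 m<n qm≤Q))

    ℓ-2^ : ∀ s → ℓ (2 ^ s) ≡ s * Q
    ℓ-2^ s = trans (cong ⌊log₂_⌋ (^-*-assoc 2 s Q)) (⌊log₂[2^n]⌋≡n (s * Q))

    ℓ-block : 0 < Q → ∀ {s n} → 2 ^ s ≤ n → n < 2 ^ suc s → s * Q ≤ ℓ n × ℓ n < Q + s * Q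
    ℓ-block Q>0 {s} {n} lo hi = subst (_≤ ℓ n) (ℓ-2^ s) (ℓ-mono lo)
      , n<2^k⇒⌊log₂n⌋<k (^>0 n Q (≤-trans (^>0 2 s (s≤s z≤n)) lo))
          (<-≤-trans (^-monoˡ-< Q {{>-nonZero Q>0}} hi) (≤-reflexive (^-*-assoc 2 (suc s) Q)))

    -- Within a cell the Q-th power of (n + r)/n stays below 2, while Bernoulli bounds it below by 1
    -- + Qr/n.
    ℓ-cell-width : ∀ n r → 0 < n → ℓ (n + r) ≡ ℓ n → Q * r < n
    ℓ-cell-width n@(suc _) r n>0 eq = +-cancelˡ-< n _ _ (*-cancelʳ-< (n ^ Q) _ _ (begin-strict
      (n + Q * r) * n ^ Q    ≤⟨ bernoulli n r Q ⟩
      n * (n + r) ^ Q        <⟨ *-monoʳ-< n (subst (λ k → (n + r) ^ Q < 2 ^ suc k) eq (n<2^1+⌊log₂n⌋ ((n + r) ^ Q))) ⟩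
      n * (2 * 2 ^ ℓ n)      ≤⟨ *-monoʳ-≤ n (*-monoʳ-≤ 2 (2^⌊log₂n⌋≤n (^>0 n Q n>0))) ⟩
      n * (2 * n ^ Q)        ≡⟨ rearrange n (n ^ Q) ⟩
      (n + n) * n ^ Q        ∎))
      where
      open ≤-Reasoning
      rearrange : ∀ n p → n * (2 * p) ≡ (n + n) * p
      rearrange = solve-∀

  -- Boxes of exponent vectors

  ∑-map : ∀ (g : A → B) (xs : List A) (f : B → ℕ) → ∑ (map g xs) f ≡ ∑ xs (λ x → f (g x))
  ∑-map g []       f = refl
  ∑-map g (x ∷ xs) f = cong (f (g x) +_) (∑-map g xs f)

  ∑-cartesianProductWith : ∀ (g : A → B → C) xs ys (f : C → ℕ) →
    ∑ (cartesianProductWith g xs ys) f ≡ ∑ xs (λ x → ∑ ys (λ y → f (g x y)))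
  ∑-cartesianProductWith g []       ys f = refl
  ∑-cartesianProductWith g (x ∷ xs) ys f = trans (∑-++ (map (g x) ys) _ f)
    (cong₂ _+_ (∑-map (g x) ys f) (∑-cartesianProductWith g xs ys f))

  ∑-1 : ∀ (xs : List A) → ∑ xs (λ _ → 1) ≡ length xs
  ∑-1 xs = trans (∑-const xs 1) (*-identityʳ (length xs))

  value : (ps : List ℕ) → Vec ℕ (length ps) → ℕ
  value []       []       = 1
  value (p ∷ ps) (a ∷ as) = p ^ a * value ps as

  value>0 : ∀ {ps} → All Prime ps → (as : Vec ℕ (length ps)) → 0 < value ps as
  value>0 []         []       = s≤s z≤n
  value>0 (pr ∷ prs) (a ∷ as) = *-mono-≤ (m^n>0 _ {{prime⇒nonZero pr}} a) (value>0 prs as)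

  prime∣prime : ∀ {p q} → Prime p → Prime q → p ∣ q → p ≡ q
  prime∣prime p-prime q-prime p∣q with prime⇒irreducible q-prime p∣q
  ... | inj₁ refl = contradiction p-prime ¬prime[1]
  ... | inj₂ p≡q  = p≡q

  prime∤1 : ∀ {p} → Prime p → ¬ p ∣ 1
  prime∤1 p-prime p∣1 with ∣1⇒≡1 p∣1
  ... | refl = ¬prime[1] p-prime

  prime∣^ : ∀ {p q} → Prime p → Prime q → ∀ a → p ∣ q ^ a → p ≡ q
  prime∣^ p-prime q-prime zero    d = contradiction d (prime∤1 p-prime)
  prime∣^ p-prime q-prime (suc a) d with euclidsLemma _ _ p-prime d
  ... | inj₁ p∣q  = prime∣prime p-prime q-prime p∣q
  ... | inj₂ p∣qᵃ = prime∣^ p-prime q-prime a p∣qᵃ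

  prime∤value : ∀ {p ps} → Prime p → All Prime ps → All (p ≢_) ps → (as : Vec ℕ (length ps)) → ¬ p ∣ value ps as
  prime∤value p-prime []         []           []       d = prime∤1 p-prime d
  prime∤value p-prime (q-prime ∷ prs) (p≢q ∷ ps≢) (a ∷ as) d with euclidsLemma _ _ p-prime d
  ... | inj₁ p∣qᵃ = p≢q (prime∣^ p-prime q-prime a p∣qᵃ)
  ... | inj₂ p∣v  = prime∤value p-prime prs ps≢ as p∣v

  ^*-injective : ∀ {p} → 0 < p → ∀ a b {v w} → ¬ p ∣ v → ¬ p ∣ w →
                 p ^ a * v ≡ p ^ b * w → a ≡ b × v ≡ w
  ^*-injective _ zero zero _ _ eq = refl , trans (sym (*-identityˡ _)) (trans eq (*-identityˡ _))
  ^*-injective {p} _ zero (suc b) {v} {w} p∤v _ eq = contradiction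
    (subst (p ∣_) (trans (sym (*-assoc p (p ^ b) w)) (trans (sym eq) (*-identityˡ v))) (m∣m*n (p ^ b * w))) p∤v
  ^*-injective {p} _ (suc a) zero {v} {w} _ p∤w eq = contradiction
    (subst (p ∣_) (trans (sym (*-assoc p (p ^ a) v)) (trans eq (*-identityˡ w))) (m∣m*n (p ^ a * v))) p∤w
  ^*-injective {p} p>0 (suc a) (suc b) {v} {w} p∤v p∤w eq
    with ^*-injective p>0 a b p∤v p∤w (*-cancelˡ-≡ _ _ p {{>-nonZero p>0}}
           (trans (sym (*-assoc p (p ^ a) v)) (trans eq (*-assoc p (p ^ b) w))))
  ... | refl , v≡w = refl , v≡w

  -- Unique factorisation, one prime at a time: the cofactor is prime to the leading prime, so the
  -- exponent of that prime is determined.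
  value-injective : ∀ {ps} → All Prime ps → Unique ps →
                    (as bs : Vec ℕ (length ps)) → value ps as ≡ value ps bs → as ≡ bs
  value-injective [] [] [] [] _ = refl
  value-injective (pr ∷ prs) (p≢ ∷ u) (a ∷ as) (b ∷ bs) eq
    with ^*-injective (>-nonZero⁻¹ _ {{prime⇒nonZero pr}}) a b
           (prime∤value pr prs p≢ as) (prime∤value pr prs p≢ bs) eq
  ... | refl , eq′ = cong (a ∷_) (value-injective prs u as bs eq′)

  module Box (M : ℕ) where

    box : ∀ r → List (Vec ℕ r)
    box zero    = [] ∷ []
    box (suc r) = cartesianProductWith _∷_ (range 0 M) (box r)

    ∈-box-∷⁺ : ∀ {r a} {as : Vec ℕ r} → a < M → as ∈ box r → (a ∷ as) ∈ box (suc r)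
    ∈-box-∷⁺ a<M as∈ = ∈-cartesianProductWith⁺ _∷_ (∈-range⁺ z≤n a<M) as∈

    ∈-box-∷⁻ : ∀ {r a} {as : Vec ℕ r} → (a ∷ as) ∈ box (suc r) → a < M × as ∈ box r
    ∈-box-∷⁻ {r} m with ∈-cartesianProductWith⁻ _∷_ (range 0 M) (box r) m
    ... | _ , _ , a∈ , as∈ , refl = proj₂ (∈-range⁻ a∈) , as∈

    box-unique : ∀ r → Unique (box r)
    box-unique zero    = [] ∷ []
    box-unique (suc r) = cartesianProductWith⁺ _∷_ ∷-injective (range-unique 0 M) (box-unique r)

    length-box : ∀ r → length (box r) ≡ M ^ r
    length-box zero    = refl
    length-box (suc r) = begin
      length (box (suc r))                        ≡⟨ ∑-1 (box (suc r)) ⟨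
      ∑ (box (suc r)) (λ _ → 1)                   ≡⟨ ∑-cartesianProductWith _∷_ (range 0 M) (box r) _ ⟩
      ∑ (range 0 M) (λ _ → ∑ (box r) (λ _ → 1))   ≡⟨ ∑-const (range 0 M) _ ⟩
      length (range 0 M) * ∑ (box r) (λ _ → 1)    ≡⟨ cong₂ _*_ (length-range 0 M) (trans (∑-1 (box r)) (length-box r)) ⟩
      M * M ^ r                                   ∎
      where open ≡-Reasoning

    -- For a vector in the box, not lying on the edge means that each coordinate can move by one in
    -- either direction without leaving the box.
    edge : ∀ {r} → Vec ℕ r → Bool
    edge []       = false
    edge (a ∷ as) with a ≟ 0 | suc a ≟ M
    ... | yes _ | _     = true
    ... | no _  | yes _ = true
    ... | no _  | no _  = edge as

    edge-∷⁻ : ∀ {r a} {as : Vec ℕ r} → edge (a ∷ as) ≡ false → a ≢ 0 × suc a ≢ M × edge as ≡ false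
    edge-∷⁻ {a = a} e with a ≟ 0 | suc a ≟ M
    ... | no a≢0 | no sa≢M = a≢0 , sa≢M , e

    edge-∷≤ : ∀ {r} a (as : Vec ℕ r) → 𝟙 (edge (a ∷ as)) ≤ δ a 0 + δ (suc a) M + 𝟙 (edge as)
    edge-∷≤ a as with a ≟ 0 | suc a ≟ M
    ... | yes _ | _     = s≤s z≤n
    ... | no _  | yes _ = s≤s z≤n
    ... | no _  | no _  = ≤-refl

    -- Each of the `r` coordinates accounts for two faces, and a face holds one M-th of the box.
    box-edges : ∀ r → M * ∑ (box r) (λ as → 𝟙 (edge as)) ≤ 2 * r * M ^ r
    box-edges zero    = ≤-reflexive (*-zeroʳ M)
    box-edges (suc r) = begin
      M * ∑ (box (suc r)) (λ as → 𝟙 (edge as))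
        ≡⟨ cong (M *_) (∑-cartesianProductWith _∷_ (range 0 M) (box r) _) ⟩
      M * ∑ (range 0 M) (λ a → ∑ (box r) (λ as → 𝟙 (edge (a ∷ as))))
        ≤⟨ *-monoʳ-≤ M (∑-mono (range 0 M) (λ a _ → ∑-mono (box r) (λ as _ → edge-∷≤ a as))) ⟩
      M * ∑ (range 0 M) (λ a → ∑ (box r) (λ as → δ a 0 + δ (suc a) M + 𝟙 (edge as)))
        ≡⟨ cong (M *_) (∑-cong (range 0 M) (λ a _ → trans (∑-distrib-+ (box r) _ _)
             (cong (_+ E) (trans (∑-const (box r) _) (*-comm (length (box r)) _))))) ⟩
      M * ∑ (range 0 M) (λ a → (δ a 0 + δ (suc a) M) * length (box r) + E)
        ≡⟨ cong (M *_) (trans (∑-distrib-+ (range 0 M) _ _) (cong₂ _+_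
             (trans (∑-*ʳ (range 0 M) (length (box r)) _) (cong₂ _*_ (∑-distrib-+ (range 0 M) _ _) (length-box r)))
             (trans (∑-const (range 0 M) E) (cong (_* E) (length-range 0 M))))) ⟩
      M * ((∑ (range 0 M) (λ a → δ a 0) + ∑ (range 0 M) (λ a → δ (suc a) M)) * M ^ r + M * E)
        ≤⟨ *-monoʳ-≤ M (+-monoˡ-≤ (M * E) (*-monoˡ-≤ (M ^ r) (+-mono-≤ first last))) ⟩
      M * (2 * M ^ r + M * E)
        ≤⟨ *-monoʳ-≤ M (+-monoʳ-≤ (2 * M ^ r) (box-edges r)) ⟩
      M * (2 * M ^ r + 2 * r * M ^ r)
        ≡⟨ collect M r (M ^ r) ⟩
      2 * suc r * M ^ suc r ∎
      where
      open ≤-Reasoning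
      E = ∑ (box r) (λ as → 𝟙 (edge as))
      first : ∑ (range 0 M) (λ a → δ a 0) ≤ 1
      first = ∑-unique (range-unique 0 M) (λ a → δ≤1 a 0) (λ _ _ p q → trans (δ>0 p) (sym (δ>0 q)))
      last : ∑ (range 0 M) (λ a → δ (suc a) M) ≤ 1
      last = ∑-unique (range-unique 0 M) (λ a → δ≤1 (suc a) M)
               (λ _ _ p q → suc-injective (trans (δ>0 p) (sym (δ>0 q))))
      collect : ∀ m r p → m * (2 * p + 2 * r * p) ≡ 2 * suc r * (m * p)
      collect = solve-∀

    value-bound : ∀ {ps} → All Prime ps → {as : Vec ℕ (length ps)} → as ∈ box (length ps) →
                  value ps as ≤ value ps (replicate _ M)
    value-bound []         {[]}     _ = ≤-refl
    value-bound (pr ∷ prs) {a ∷ as} m with ∈-box-∷⁻ m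
    ... | a<M , as∈ = *-mono-≤ (^-monoʳ-≤ _ {{prime⇒nonZero pr}} (<⇒≤ a<M)) (value-bound prs as∈)

    lower : ∀ {ps : List ℕ} {p} → p ∈ ps → {as : Vec ℕ (length ps)} → as ∈ box (length ps) → edge as ≡ false →
            ∃ λ bs → bs ∈ box (length ps) × value ps as ≡ p * value ps bs
    lower {p ∷ ps} (here refl) {a ∷ as} m e with ∈-box-∷⁻ m | edge-∷⁻ {a = a} {as} e
    ... | a<M , as∈ | a≢0 , _ , _ with a
    ...   | zero  = contradiction refl a≢0
    ...   | suc b = (b ∷ as) , ∈-box-∷⁺ (<-trans (n<1+n b) a<M) as∈ , *-assoc p (p ^ b) _
    lower {q ∷ ps} {p} (there p∈) {a ∷ as} m e with ∈-box-∷⁻ m | edge-∷⁻ {a = a} {as} e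
    ... | a<M , as∈ | _ , _ , e′ with lower p∈ as∈ e′
    ...   | bs , bs∈ , eq = (a ∷ bs) , ∈-box-∷⁺ a<M bs∈ , trans (cong (q ^ a *_) eq) (swap (q ^ a) p _)
      where
      swap : ∀ x y z → x * (y * z) ≡ y * (x * z)
      swap = solve-∀

    raise : ∀ {ps : List ℕ} {p} → p ∈ ps → {as : Vec ℕ (length ps)} → as ∈ box (length ps) → edge as ≡ false →
            ∃ λ bs → bs ∈ box (length ps) × value ps bs ≡ p * value ps as
    raise {p ∷ ps} (here refl) {a ∷ as} m e with ∈-box-∷⁻ m | edge-∷⁻ {a = a} {as} e
    ... | a<M , as∈ | _ , sa≢M , _ = (suc a ∷ as) , ∈-box-∷⁺ (≤∧≢⇒< a<M sa≢M) as∈ , *-assoc p (p ^ a) _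
    raise {q ∷ ps} {p} (there p∈) {a ∷ as} m e with ∈-box-∷⁻ m | edge-∷⁻ {a = a} {as} e
    ... | a<M , as∈ | _ , _ , e′ with raise p∈ as∈ e′
    ...   | bs , bs∈ , eq = (a ∷ bs) , ∈-box-∷⁺ a<M bs∈ , trans (cong (q ^ a *_) eq) (swap (q ^ a) p _)
      where
      swap : ∀ x y z → x * (y * z) ≡ y * (x * z)
      swap = solve-∀

  -- The character and residues

  -- The completely multiplicative extension of the nontrivial character mod 3 taking the
  -- value 1 at 3, with values ±1 encoded as false and true.
  u-fuel : ℕ → ℕ → Bool
  u-fuel zero    n = false
  u-fuel (suc f) n with n % 3
  ... | 0 = u-fuel f (n / 3)
  ... | 1 = false
  ... | _ = true

  u : ℕ → Bool
  u n = u-fuel n n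

  u-fuel-0 : ∀ f → u-fuel f 0 ≡ false
  u-fuel-0 zero    = refl
  u-fuel-0 (suc f) = u-fuel-0 f

  u-fuel-irrelevant : ∀ {f f′} n → n ≤ f → n ≤ f′ → u-fuel f n ≡ u-fuel f′ n
  u-fuel-irrelevant {zero}  {f′}     zero _ _ = sym (u-fuel-0 f′)
  u-fuel-irrelevant {suc f} {zero}   zero _ _ = u-fuel-0 (suc f)
  u-fuel-irrelevant {suc f} {suc f′} zero _ _ = trans (u-fuel-0 f) (sym (u-fuel-0 f′))
  u-fuel-irrelevant {suc f} {suc f′} n@(suc m) (s≤s le) (s≤s le′) with n % 3
  ... | 0 = u-fuel-irrelevant (n / 3) (≤-trans n/3≤m le) (≤-trans n/3≤m le′)
    where
    n/3≤m : n / 3 ≤ m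
    n/3≤m = ≤-pred (m/n<m n 3 (s≤s (s≤s z≤n)))
  ... | 1 = refl
  ... | suc (suc _) = refl

  u-3* : ∀ n → u (3 * n) ≡ u n
  u-3* zero    = refl
  u-3* n@(suc m) = trans (unfold (3 * n) (3n%3≡0) ) (trans
    (u-fuel-irrelevant {pred (3 * n)} {n} (3 * n / 3) (≤-trans (≤-reflexive quot) (≤-trans (m≤m+n n _) (m≤n+m _ m))) (≤-reflexive quot))
    (cong (u-fuel n) quot))
    where
    3n%3≡0 : 3 * n % 3 ≡ 0
    3n%3≡0 = trans (cong (_% 3) (*-comm 3 n)) (m*n%n≡0 n 3)
    quot : 3 * n / 3 ≡ n
    quot = trans (cong (_/ 3) (*-comm 3 n)) (m*n/n≡m n 3)
    unfold : ∀ k → k % 3 ≡ 0 → u k ≡ u-fuel (pred k) (k / 3)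
    unfold zero    _ = refl
    unfold (suc k) eq rewrite eq = refl

  residue-sign : ℕ → Bool
  residue-sign 2 = true
  residue-sign _ = false

  u-residue : ∀ n → n % 3 ≢ 0 → u n ≡ residue-sign (n % 3)
  u-residue zero    n%3≢0 = contradiction refl n%3≢0
  u-residue n@(suc m) n%3≢0 with n % 3 | m%n<n n 3
  ... | 0 | _ = contradiction refl n%3≢0
  ... | 1 | _ = refl
  ... | 2 | _ = refl
  ... | suc (suc (suc _)) | s≤s (s≤s (s≤s ()))

  residue-product : ∀ r s → r < 3 → s < 3 → r ≢ 0 → s ≢ 0 →
    (r * s) % 3 ≢ 0 × residue-sign ((r * s) % 3) ≡ residue-sign r xor residue-sign s
  residue-product 0 _ _ _ r≢0 _ = contradiction refl r≢0
  residue-product (suc _) 0 _ _ _ s≢0 = contradiction refl s≢0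
  residue-product 1 1 _ _ _ _ = (λ ()) , refl
  residue-product 1 2 _ _ _ _ = (λ ()) , refl
  residue-product 2 1 _ _ _ _ = (λ ()) , refl
  residue-product 2 2 _ _ _ _ = (λ ()) , refl
  residue-product (suc (suc (suc _))) _ (s≤s (s≤s (s≤s ()))) _ _ _
  residue-product (suc _) (suc (suc (suc _))) _ (s≤s (s≤s (s≤s ()))) _ _

  third : ∀ n → n % 3 ≡ 0 → n ≡ 3 * (n / 3)
  third n eq = trans (m≡m%n+[m/n]*n n 3) (trans (cong (_+ n / 3 * 3) eq) (*-comm (n / 3) 3))

  third-pos : ∀ n → 0 < n → n % 3 ≡ 0 → 0 < n / 3
  third-pos n n>0 eq with n / 3 in e
  ... | suc _ = s≤s z≤n
  ... | zero  = contradiction (trans (third n eq) (cong (3 *_) e)) (>⇒≢ n>0)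

  u-* : ∀ m n → 0 < m → 0 < n → u (m * n) ≡ u m xor u n
  u-* m n = go m n (<-wellFounded m) (<-wellFounded n)
    where
    go : ∀ m n → Acc _<_ m → Acc _<_ n → 0 < m → 0 < n → u (m * n) ≡ u m xor u n
    go m n (acc rm) an@(acc rn) m>0 n>0 with m % 3 ≟ 0 | n % 3 ≟ 0
    ... | yes m₀ | _ = begin
        u (m * n)           ≡⟨ cong (λ z → u (z * n)) (third m m₀) ⟩
        u (3 * k * n)       ≡⟨ cong u (*-assoc 3 k n) ⟩
        u (3 * (k * n))     ≡⟨ u-3* (k * n) ⟩
        u (k * n)           ≡⟨ go k n (rm (m/n<m m 3 {{>-nonZero m>0}} (s≤s (s≤s z≤n)))) an (third-pos m m>0 m₀) n>0 ⟩
        u k xor u n         ≡⟨ cong (_xor u n) (trans (sym (u-3* k)) (cong u (sym (third m m₀)))) ⟩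
        u m xor u n         ∎
      where open ≡-Reasoning
            k = m / 3
    ... | no _ | yes n₀ = begin
        u (m * n)           ≡⟨ cong (λ z → u (m * z)) (third n n₀) ⟩
        u (m * (3 * k))     ≡⟨ cong u (swap m k) ⟩
        u (3 * (m * k))     ≡⟨ u-3* (m * k) ⟩
        u (m * k)           ≡⟨ go m k (acc rm) (rn (m/n<m n 3 {{>-nonZero n>0}} (s≤s (s≤s z≤n)))) m>0 (third-pos n n>0 n₀) ⟩
        u m xor u k         ≡⟨ cong (u m xor_) (trans (sym (u-3* k)) (cong u (sym (third n n₀)))) ⟩
        u m xor u n         ∎
      where open ≡-Reasoning
            k = n / 3
            swap : ∀ m k → m * (3 * k) ≡ 3 * (m * k)
            swap = solve-∀
    ... | no m≢0 | no n≢0 with residue-product (m % 3) (n % 3) (m%n<n m 3) (m%n<n n 3) m≢0 n≢0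
    ...   | mn≢0 , eq = begin
        u (m * n)                                    ≡⟨ u-residue (m * n) (λ z → mn≢0 (trans (sym (%-distribˡ-* m n 3)) z)) ⟩
        residue-sign ((m * n) % 3)                   ≡⟨ cong residue-sign (%-distribˡ-* m n 3) ⟩
        residue-sign ((m % 3) * (n % 3) % 3)         ≡⟨ eq ⟩
        residue-sign (m % 3) xor residue-sign (n % 3) ≡⟨ cong₂ _xor_ (u-residue m m≢0) (u-residue n n≢0) ⟨
        u m xor u n                                  ∎
      where open ≡-Reasoning

  odd : ℕ → Bool
  odd zero    = false
  odd (suc n) = not (odd n)

  %-≡⇒∃ : ∀ {m n} d .{{_ : NonZero d}} → m % d ≡ n % d → m / d ≤ n / d → ∃ λ k → n ≡ m + k * d
  %-≡⇒∃ {m} {n} d eq le = n / d ∸ m / d , (begin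
    n                                            ≡⟨ m≡m%n+[m/n]*n n d ⟩
    n % d + n / d * d                            ≡⟨ cong₂ (λ r q → r + q * d) (sym eq) (sym (m+[n∸m]≡n le)) ⟩
    m % d + (m / d + (n / d ∸ m / d)) * d        ≡⟨ shuffle (m % d) (m / d) (n / d ∸ m / d) d ⟩
    m % d + m / d * d + (n / d ∸ m / d) * d      ≡⟨ cong (_+ (n / d ∸ m / d) * d) (m≡m%n+[m/n]*n m d) ⟨
    m + (n / d ∸ m / d) * d                      ∎)
    where
    open ≡-Reasoning
    shuffle : ∀ a b c d → a + (b + c) * d ≡ a + b * d + c * d
    shuffle = solve-∀

  no-wrap : ∀ {a d m n} → (∃ λ k → n ≡ m + k * d) → a ≤ m → n < d + a → m ≡ n
  no-wrap (zero , e) _ _ = sym (trans e (+-identityʳ _))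
  no-wrap {a} {d} (suc k , e) lm un = contradiction un (≤⇒≯ (≤-trans (≤-reflexive (+-comm d a))
    (≤-trans (+-mono-≤ lm (m≤m+n d (k * d))) (≤-reflexive (sym e)))))

  %-window-injective : ∀ {a m n} d .{{_ : NonZero d}} → a ≤ m → m < d + a → a ≤ n → n < d + a →
                       m % d ≡ n % d → m ≡ n
  %-window-injective {a} {m} {n} d lm um ln un eq with ≤-total (m / d) (n / d)
  ... | inj₁ le = no-wrap (%-≡⇒∃ d eq le) lm un
  ... | inj₂ le = sym (no-wrap (%-≡⇒∃ d (sym eq) le) ln um)

  [m%d+n]%d : ∀ m n d .{{_ : NonZero d}} → (m % d + n) % d ≡ (m + n) % d
  [m%d+n]%d m n d = trans (%-distribˡ-+ (m % d) n d)
    (trans (cong (λ z → (z + n % d) % d) (m%n%n≡m%n m d)) (sym (%-distribˡ-+ m n d)))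

  ∑-fibres : ∀ {A : Set} (xs : List A) (h : A → ℕ) {N} → (∀ x → h x < N) → ∀ (f : ℕ → ℕ) c →
             (∀ y → ∑ xs (λ x → δ (h x) y) ≤ c) → ∑ xs (λ x → f (h x)) ≤ c * ∑ (range 0 N) f
  ∑-fibres xs h {N} h<N f c fib = begin
    ∑ xs (λ x → f (h x))
      ≡⟨ ∑-cong xs (λ x _ → ∑-δˡ (h<N x) f) ⟨
    ∑ xs (λ x → ∑ (range 0 N) (λ y → δ (h x) y * f y))
      ≡⟨ ∑-swap xs (range 0 N) _ ⟩
    ∑ (range 0 N) (λ y → ∑ xs (λ x → δ (h x) y * f y))
      ≡⟨ ∑-cong (range 0 N) (λ y _ → ∑-*ʳ xs (f y) _) ⟩
    ∑ (range 0 N) (λ y → ∑ xs (λ x → δ (h x) y) * f y)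
      ≤⟨ ∑-mono (range 0 N) (λ y _ → *-monoˡ-≤ (f y) (fib y)) ⟩
    ∑ (range 0 N) (λ y → c * f y)
      ≡⟨ ∑-*ˡ (range 0 N) c f ⟩
    c * ∑ (range 0 N) f ∎
    where open ≤-Reasoning

  -- A rotation of the cycle is injective, so no value of `f` is counted twice.
  ∑-shift : ∀ Q .{{_ : NonZero Q}} c (f : ℕ → ℕ) →
            ∑ (range 0 Q) (λ x → f ((x + c) % Q)) ≤ ∑ (range 0 Q) f
  ∑-shift Q c f = ≤-trans (∑-fibres (range 0 Q) (λ x → (x + c) % Q) (λ x → m%n<n (x + c) Q) f 1
      (λ y → ∑-unique (range-unique 0 Q) (λ x → δ≤1 _ y) (λ {x} {x′} m m′ p p′ →
         +-cancelʳ-≡ c x x′ (%-window-injective Q (m≤n+m c x) (+-monoˡ-< c (proj₂ (∈-range⁻ m)))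
           (m≤n+m c x′) (+-monoˡ-< c (proj₂ (∈-range⁻ m′))) (trans (δ>0 p) (sym (δ>0 p′)))))))
    (≤-reflexive (*-identityˡ _))

  -- From the smallest point of the support on, only `R` places are available.
  ∑-clustered : ∀ a len R (f : ℕ → ℕ) → (∀ x → f x ≤ 1) →
    (∀ {m n} → m ∈ range a len → n ∈ range a len → m ≤ n → 0 < f m → 0 < f n → n < m + R) →
    ∑ (range a len) f ≤ R
  ∑-clustered a zero R f f≤1 close = z≤n
  ∑-clustered a (suc len) R f f≤1 close with 0 <? f a
  ... | no fa≯0 rewrite n<1⇒n≡0 (≰⇒> fa≯0) =
    ∑-clustered (suc a) len R f f≤1 (λ m n → close (there m) (there n))
  ... | yes fa>0 with suc len ≤? R
  ...   | yes short = ≤-trans (∑-bound (range a (suc len)) 1 (λ x _ → f≤1 x)) (≤-trans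
          (≤-reflexive (trans (*-identityʳ _) (length-range a (suc len)))) short)
  ...   | no long = begin
    ∑ (range a (suc len)) f               ≡⟨ cong (λ k → ∑ (range a k) f) split ⟨
    ∑ (range a (R + k)) f                 ≡⟨ ∑-range-+ a R k f ⟩
    ∑ (range a R) f + ∑ (range (a + R) k) f ≡⟨ cong (∑ (range a R) f +_) (trans (∑-cong (range (a + R) k) far) (∑-zero (range (a + R) k))) ⟩
    ∑ (range a R) f + 0                   ≡⟨ +-identityʳ _ ⟩
    ∑ (range a R) f                       ≤⟨ ∑-bound (range a R) 1 (λ x _ → f≤1 x) ⟩
    length (range a R) * 1                ≡⟨ trans (*-identityʳ _) (length-range a R) ⟩
    R                                     ∎
    where
    open ≤-Reasoning
    k = suc len ∸ R
    split : R + k ≡ suc len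
    split = m+[n∸m]≡n (<⇒≤ (≰⇒> long))
    far : ∀ x → x ∈ range (a + R) k → f x ≡ 0
    far x m with ∈-range⁻ m | 0 <? f x
    ... | lo , hi | no fx≯0 = n<1⇒n≡0 (≰⇒> fx≯0)
    ... | lo , hi | yes fx>0 = contradiction (close (here refl) (∈-range⁺ (≤-trans (m≤m+n a R) lo)
            (subst (x <_) (trans (+-assoc a R k) (cong (a +_) split)) hi)) (≤-trans (m≤m+n a R) lo) fa>0 fx>0) (≤⇒≯ lo)

  -- Stages

  block : ℕ → List ℕ
  block s = range (2 ^ s) (2 ^ s)

  ∈-block⁻ : ∀ {s n} → n ∈ block s → 2 ^ s ≤ n × n < 2 ^ suc s
  ∈-block⁻ {s} {n} m with ∈-range⁻ m
  ... | lo , hi = lo , subst (λ z → n < 2 ^ s + z) (sym (+-identityʳ (2 ^ s))) hi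

  -- A solution of sign (p n) = u p xor sign n, where bad n is 0, for the primes p ≤ K; label is an
  -- approximately invariant function none of whose level sets is large.
  record Stage (K : ℕ) : Set where
    field
      period      : ℕ
      index       : ℕ → ℕ
      label       : ℕ → ℕ
      sign        : ℕ → Bool
      bad         : ℕ → ℕ
      index-mono  : ∀ {m n} → m ≤ n → index m ≤ index n
      index-block : ∀ s → index (2 ^ suc s) ≡ period + index (2 ^ s)
      label-index : ∀ {m n} → index m ≡ index n → label m ≡ label n
      sign-index  : ∀ {m n} → index m ≡ index n → sign m ≡ sign n
      label<period : ∀ n → label n < period
      label-invariant : ∀ {p n} → Prime p → p ≤ K → 0 < n → bad n ≡ 0 → label (p * n) ≡ label n
      sign-equivariant : ∀ {p n} → Prime p → p ≤ K → 0 < n → bad n ≡ 0 → sign (p * n) ≡ u p xor sign n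
      bad-rare    : ∀ s → period ≤ 2 ^ s → suc K * ∑ (block s) bad ≤ 2 ^ s
      label-rare  : ∀ s y → period ≤ 2 ^ s → suc K * ∑ (block s) (λ n → δ (label n) y) ≤ 2 ^ s

  OddPrime : ℕ → Set
  OddPrime p = Prime p × p ≢ 2

  oddPrime? : ∀ p → Dec (OddPrime p)
  oddPrime? p = prime? p ×-dec ¬? (p ≟ 2)

  xor-solve : ∀ a b c d → a ≡ b xor d → d xor c ≡ b xor (a xor c)
  xor-solve _ false false false refl = refl
  xor-solve _ false false true  refl = refl
  xor-solve _ false true  false refl = refl
  xor-solve _ false true  true  refl = refl
  xor-solve _ true  false false refl = refl
  xor-solve _ true  false true  refl = refl
  xor-solve _ true  true  false refl = refl
  xor-solve _ true  true  true  refl = refl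

  -- Frequencies of cells among the integers of a dyadic block

  module BlockSums (Q : ℕ) .{{_ : NonZero Q}} where
    open Log Q

    -- A dyadic block runs exactly once round the cycle, so equal residues mean the same cell, and
    -- `ℓ-cell-width` bounds the distance of two integers in it.
    cell-count : ∀ s y → ∑ (block s) (λ n → δ (ℓ n % Q) y) ≤ suc (2 ^ suc s / Q)
    cell-count s y = ∑-clustered (2 ^ s) (2 ^ s) _ _ (λ n → δ≤1 _ y) close
      where
      close : ∀ {m n} → m ∈ block s → n ∈ block s → m ≤ n → 0 < δ (ℓ m % Q) y → 0 < δ (ℓ n % Q) y →
              n < m + suc (2 ^ suc s / Q)
      close {m} {n} m∈ n∈ m≤n p q with ∈-block⁻ {s} m∈ | ∈-block⁻ {s} n∈
      ... | lm , um | ln , un = begin-strict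
        n                       ≡⟨ m+[n∸m]≡n m≤n ⟨
        m + (n ∸ m)             <⟨ +-monoʳ-< m (s≤s r≤) ⟩
        m + suc (2 ^ suc s / Q) ∎
        where
        open ≤-Reasoning
        same : ℓ m ≡ ℓ n
        same with ℓ-block (>-nonZero⁻¹ Q) {s} lm um | ℓ-block (>-nonZero⁻¹ Q) {s} ln un
        ... | a , b | c , d = %-window-injective Q a b c d (trans (δ>0 p) (sym (δ>0 q)))
        r*Q≤ : (n ∸ m) * Q ≤ 2 ^ suc s
        r*Q≤ = <⇒≤ (<-trans (subst (_< m) (*-comm Q (n ∸ m)) (ℓ-cell-width m (n ∸ m) (≤-trans (^>0 2 s (s≤s z≤n)) lm)
                 (trans (cong ℓ (m+[n∸m]≡n m≤n)) (sym same)))) um)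
        r≤ : n ∸ m ≤ 2 ^ suc s / Q
        r≤ = ≤-trans (≤-reflexive (sym (m*n/n≡m (n ∸ m) Q))) (/-monoˡ-≤ Q r*Q≤)

    -- Transfers sparsity from cells to integers. A cell holds at most `c` integers of the block,
    -- where `c * Q` is at most `Q + 2 ^ suc s`, hence at most three times `2 ^ s`; the factor 4 in
    -- the hypothesis absorbs this.
    block-rare : ∀ K (f : ℕ → ℕ) → 4 * K * ∑ (range 0 Q) f ≤ Q →
                 ∀ s → Q ≤ 2 ^ s → K * ∑ (block s) (λ n → f (ℓ n % Q)) ≤ 2 ^ s
    block-rare K f sparse s Q≤ = *-cancelˡ-≤ 4 (begin
      4 * (K * ∑ (block s) (λ n → f (ℓ n % Q)))
        ≤⟨ *-monoʳ-≤ 4 (*-monoʳ-≤ K (∑-fibres (block s) (λ n → ℓ n % Q) (λ n → m%n<n (ℓ n) Q) f c (cell-count s))) ⟩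
      4 * (K * (c * ∑ (range 0 Q) f))     ≡⟨ rearrange K c _ ⟩
      c * (4 * K * ∑ (range 0 Q) f)       ≤⟨ *-monoʳ-≤ c sparse ⟩
      Q + 2 ^ suc s / Q * Q               ≤⟨ +-mono-≤ Q≤ (m/n*n≤m (2 ^ suc s) Q) ⟩
      2 ^ s + 2 ^ suc s                   ≤⟨ m≤m+n _ (2 ^ s) ⟩
      2 ^ s + 2 ^ suc s + 2 ^ s           ≡⟨ four (2 ^ s) ⟩
      4 * 2 ^ s ∎)
      where
      open ≤-Reasoning
      c = suc (2 ^ suc s / Q)
      rearrange : ∀ k c x → 4 * (k * (c * x)) ≡ c * (4 * k * x)
      rearrange = solve-∀
      four : ∀ x → x + 2 * x + x ≡ 4 * x
      four = solve-∀

  -- The stage for the primes up to K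

  module Construction (K : ℕ) (ps : List ℕ) (primes : All Prime ps) (odds : All (2 ≢_) ps)
    (distinct : Unique ps) (∈-ps : ∀ {p} → Prime p → p ≢ 2 → p ≤ K → p ∈ ps)
    (R M Q : ℕ) .{{_ : NonZero Q}} (M>0 : 0 < M) (R-def : R ≡ 4 * suc K * (1 + suc K * 2))
    (M-def : M ≡ 2 * suc (length ps) * R)
    (gap : M * value ps (replicate _ M) ≤ Q) (volume≤Q : 4 * suc K * M ^ suc (length ps) ≤ Q)
    where

    dim shifts volume : ℕ
    dim    = suc (length ps)
    shifts = suc K * 2
    volume = M ^ dim

    open Box M

    bound : ℕ
    bound = value ps (replicate _ M)

    volume>0 : 0 < volume
    volume>0 = ^>0 M dim M>0

    open Log Q

    shape : List (Vec ℕ dim)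
    shape = box dim

    -- The coordinate `b` carries no prime: `ℓ (p * n)` may exceed `ℓ p + ℓ n` by one, and shifts of
    -- `b` absorb such errors. The prime 2 is not in `ps` since doubling is a full turn of the
    -- cycle.
    off : Vec ℕ dim → ℕ
    off (b ∷ as) = ℓ (value ps as) + b

    separated : ∀ {m n b} → 0 < m → m ≤ bound → m < n → b < M → ∀ c → ℓ m + b ≢ ℓ n + c
    separated {m} {n} {b} m>0 m≤ m<n b<M c eq = <-irrefl eq (begin-strict
      ℓ m + b   <⟨ +-monoʳ-< (ℓ m) b<M ⟩
      ℓ m + M   ≡⟨ +-comm (ℓ m) M ⟩
      M + ℓ m   ≤⟨ ℓ-gap M m>0 m<n (≤-trans (*-monoʳ-≤ M m≤) gap) ⟩
      ℓ n       ≤⟨ m≤m+n _ c ⟩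
      ℓ n + c   ∎)
      where open ≤-Reasoning

    -- If `2 ^ k * v` and `v′` differed, the smaller one would be at most `bound`, so their values
    -- of `ℓ` would be at least `M` apart, more than the first coordinates can make up. If they
    -- agree, `k` is 0 because `v′` is odd, and unique factorisation applies.
    off-shift : ∀ {e e′} → e ∈ shape → e′ ∈ shape → ∀ k → off e′ ≡ off e + k * Q → e ≡ e′
    off-shift {b ∷ as} {b′ ∷ as′} m m′ k eq with ∈-box-∷⁻ m | ∈-box-∷⁻ m′
    ... | b<M , as∈ | b′<M , as′∈ = by-cases (<-cmp v′ (2 ^ k * v))
      where
      v v′ : ℕ
      v  = value ps as
      v′ = value ps as′
      v>0 : 0 < v
      v>0 = value>0 primes as
      shifted : ℓ v′ + b′ ≡ ℓ (2 ^ k * v) + b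
      shifted = trans eq (trans (swap (ℓ v) b (k * Q)) (cong (_+ b) (sym (ℓ-2^* k v>0))))
        where
        swap : ∀ x y z → x + y + z ≡ z + x + y
        swap = solve-∀
      aligned : ∀ k → v′ ≡ 2 ^ k * v → v ≡ v′
      aligned zero    e = sym (trans e (*-identityˡ v))
      aligned (suc k) e = contradiction (subst (2 ∣_) (sym (trans e (*-assoc 2 (2 ^ k) v))) (m∣m*n (2 ^ k * v)))
                            (prime∤value prime[2] primes odds as′)
      by-cases : Tri (v′ < 2 ^ k * v) (v′ ≡ 2 ^ k * v) (v′ > 2 ^ k * v) → b ∷ as ≡ b′ ∷ as′
      by-cases (tri< lt _ _) = contradiction shifted
        (separated (value>0 primes as′) (value-bound primes as′∈) lt b′<M b)
      by-cases (tri> _ _ gt) = contradiction (sym shifted)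
        (separated (*-mono-≤ (^>0 2 k (s≤s z≤n)) v>0) (≤-trans (<⇒≤ gt) (value-bound primes as′∈)) gt b<M b′)
      by-cases (tri≈ _ e _) = cong₂ _∷_
        (sym (+-cancelˡ-≡ (ℓ v′) b′ b (trans shifted (cong (λ z → ℓ z + b) (sym e)))))
        (value-injective primes distinct as as′ (aligned k e))

    off-injective : ∀ x {e e′} → e ∈ shape → e′ ∈ shape → (x + off e) % Q ≡ (x + off e′) % Q → e ≡ e′
    off-injective x {e} {e′} m m′ eq with ≤-total ((x + off e) / Q) ((x + off e′) / Q)
    ... | inj₁ le with %-≡⇒∃ Q eq le
    ...   | k , p = off-shift m m′ k (+-cancelˡ-≡ x _ _ (trans p (+-assoc x (off e) _)))
    off-injective x {e} {e′} m m′ eq | inj₂ le with %-≡⇒∃ Q (sym eq) le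
    ...   | k , p = sym (off-shift m′ m k (+-cancelˡ-≡ x _ _ (trans p (+-assoc x (off e′) _))))

    few-edges : R * ∑ shape (λ e → 𝟙 (edge e)) ≤ length shape
    few-edges = *-cancelˡ-≤ (2 * dim) (begin
      2 * dim * (R * ∑ shape (λ e → 𝟙 (edge e))) ≡⟨ trans (cong (_* ∑ shape (λ e → 𝟙 (edge e))) M-def) (*-assoc (2 * dim) R _) ⟨
      M * ∑ shape (λ e → 𝟙 (edge e))             ≤⟨ box-edges dim ⟩
      2 * dim * M ^ dim                          ≡⟨ cong (2 * dim *_) (length-box dim) ⟨
      2 * dim * length shape                     ∎)
      where open ≤-Reasoning

    at : ℕ → Vec ℕ dim → ℕ
    at x e = (x + off e) % Q

    product : Vec ℕ dim → ℕ
    product (_ ∷ as) = value ps as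

    product>0 : ∀ e → 0 < product e
    product>0 (_ ∷ as) = value>0 primes as

    -- One exponent drops by one, and `b` becomes `b + η ∸ d`, where `η` is the rounding error of
    -- `ℓ` for this product and `d` that of the caller. Both are at most 1, so off the edge the
    -- subtraction does not truncate and the result stays in the box.
    step-down : ∀ {p d} → p ∈ ps → d ≤ 1 → ∀ {e} → e ∈ shape → edge e ≡ false →
      ∃ λ e′ → e′ ∈ shape × ℓ p + d + off e′ ≡ off e × product e ≡ p * product e′
    step-down {p} {d} p∈ d≤1 {b ∷ as} m i with ∈-box-∷⁻ m | edge-∷⁻ {a = b} {as} i
    ... | b<M , as∈ | b≢0 , sb≢M , i′ with lower p∈ as∈ i′
    ...   | as′ , as′∈ , eq with ℓ-* (>-nonZero⁻¹ p {{prime⇒nonZero (All.lookup primes p∈)}}) (value>0 primes as′)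
    ...     | η , η≤1 , ℓ-eq = (b + η ∸ d ∷ as′)
              , ∈-box-∷⁺ (≤-<-trans (m∸n≤m (b + η) d) (≤-<-trans (+-monoʳ-≤ b η≤1)
                  (subst (_< M) (+-comm 1 b) (≤∧≢⇒< b<M sb≢M)))) as′∈
              , (begin
                ℓ p + d + (ℓ (value ps as′) + (b + η ∸ d))   ≡⟨ shuffle₁ (ℓ p) d _ _ ⟩
                ℓ p + ℓ (value ps as′) + (d + (b + η ∸ d))   ≡⟨ cong (ℓ p + ℓ (value ps as′) +_) (m+[n∸m]≡n d≤) ⟩
                ℓ p + ℓ (value ps as′) + (b + η)             ≡⟨ shuffle₂ (ℓ p) _ b η ⟩
                ℓ p + ℓ (value ps as′) + η + b               ≡⟨ cong (_+ b) ℓ-eq ⟨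
                ℓ (p * value ps as′) + b                     ≡⟨ cong (λ z → ℓ z + b) eq ⟨
                ℓ (value ps as) + b                          ∎)
              , eq
      where
      open ≡-Reasoning
      d≤ : d ≤ b + η
      d≤ = ≤-trans d≤1 (≤-trans (n≢0⇒n>0 b≢0) (m≤m+n b η))
      shuffle₁ : ∀ a b c d → a + b + (c + d) ≡ a + c + (b + d)
      shuffle₁ = solve-∀
      shuffle₂ : ∀ a b c d → a + b + (c + d) ≡ a + b + d + c
      shuffle₂ = solve-∀

    -- The inverse move, needed because consistency of the tiling compares the two cells in both
    -- directions.
    step-up : ∀ {p d} → p ∈ ps → d ≤ 1 → ∀ {e′} → e′ ∈ shape → edge e′ ≡ false →
      ∃ λ e → e ∈ shape × off e ≡ ℓ p + d + off e′
    step-up {p} {d} p∈ d≤1 {b ∷ as} m i with ∈-box-∷⁻ m | edge-∷⁻ {a = b} {as} i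
    ... | b<M , as∈ | b≢0 , sb≢M , i′ with raise p∈ as∈ i′
    ...   | as′ , as′∈ , eq with ℓ-* (>-nonZero⁻¹ p {{prime⇒nonZero (All.lookup primes p∈)}}) (value>0 primes as)
    ...     | η , η≤1 , ℓ-eq = (b + d ∸ η ∷ as′)
              , ∈-box-∷⁺ (≤-<-trans (m∸n≤m (b + d) η) (≤-<-trans (+-monoʳ-≤ b d≤1)
                  (subst (_< M) (+-comm 1 b) (≤∧≢⇒< b<M sb≢M)))) as′∈
              , (begin
                ℓ (value ps as′) + (b + d ∸ η)               ≡⟨ cong (λ z → ℓ z + (b + d ∸ η)) eq ⟩
                ℓ (p * value ps as) + (b + d ∸ η)            ≡⟨ cong (_+ (b + d ∸ η)) ℓ-eq ⟩
                ℓ p + ℓ (value ps as) + η + (b + d ∸ η)      ≡⟨ +-assoc (ℓ p + ℓ (value ps as)) η _ ⟩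
                ℓ p + ℓ (value ps as) + (η + (b + d ∸ η))    ≡⟨ cong (ℓ p + ℓ (value ps as) +_) (m+[n∸m]≡n η≤) ⟩
                ℓ p + ℓ (value ps as) + (b + d)              ≡⟨ shuffle (ℓ p) _ b d ⟩
                ℓ p + d + (ℓ (value ps as) + b)              ∎)
      where
      open ≡-Reasoning
      η≤ : η ≤ b + d
      η≤ = ≤-trans η≤1 (≤-trans (n≢0⇒n>0 b≢0) (m≤m+n b d))
      shuffle : ∀ a b c d → a + b + (c + d) ≡ a + d + (b + c)
      shuffle = solve-∀

    Consistent : (ℕ → Vec ℕ dim) → Set
    Consistent el = ∀ {x x′} → x < Q → x′ < Q →
      (∀ {e} → e ∈ shape → edge e ≡ false → ∃ λ e′ → e′ ∈ shape × at x′ e′ ≡ at x e) →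
      (∀ {e} → e ∈ shape → edge e ≡ false → ∃ λ e′ → e′ ∈ shape × at x e′ ≡ at x′ e) →
      edge (el x) ≡ false → edge (el x′) ≡ false → at x (el x) ≡ at x′ (el x′)

    module Tiled (el : ℕ → Vec ℕ dim) (el∈ : ∀ {x} → x < Q → el x ∈ shape)
      (el-consistent : Consistent el)
      (few-edge-cells : R * ∑ (range 0 Q) (λ x → 𝟙 (edge (el x))) ≤ Q) where

      element : ℕ → Vec ℕ dim
      element j = el (j % Q)

      element∈ : ∀ j → element j ∈ shape
      element∈ j = el∈ (m%n<n j Q)

      marker : ℕ → ℕ
      marker j = j + off (element j)

      edgeAt : ℕ → ℕ
      edgeAt x = 𝟙 (edge (el x))

      edgeAt≡0 : ∀ j → edgeAt (j % Q) ≡ 0 → edge (element j) ≡ false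
      edgeAt≡0 j eq with edge (element j)
      ... | false = refl

      at-% : ∀ j e → at (j % Q) e ≡ (j + off e) % Q
      at-% j e = [m%d+n]%d j (off e) Q

      moved : ∀ j c e e′ → c + off e′ ≡ off e → at ((j + c) % Q) e′ ≡ at (j % Q) e
      moved j c e e′ eq = trans (at-% (j + c) e′) (trans (cong (_% Q)
        (trans (+-assoc j c (off e′)) (cong (j +_) eq))) (sym (at-% j e)))

      consistent : ∀ {p d} → p ∈ ps → d ≤ 1 → ∀ j →
        edge (element j) ≡ false → edge (element (j + (ℓ p + d))) ≡ false →
        at (j % Q) (element j) ≡ at ((j + (ℓ p + d)) % Q) (element (j + (ℓ p + d)))
      consistent {p} {d} p∈ d≤1 j = el-consistent (m%n<n j Q) (m%n<n (j + (ℓ p + d)) Q) forward backward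
        where
        forward : ∀ {e} → e ∈ shape → edge e ≡ false →
          ∃ λ e′ → e′ ∈ shape × at ((j + (ℓ p + d)) % Q) e′ ≡ at (j % Q) e
        forward {e} m i with step-down p∈ d≤1 m i
        ... | e′ , m′ , eq , _ = e′ , m′ , moved j (ℓ p + d) e e′ eq
        backward : ∀ {e} → e ∈ shape → edge e ≡ false →
          ∃ λ e′ → e′ ∈ shape × at (j % Q) e′ ≡ at ((j + (ℓ p + d)) % Q) e
        backward {e} m i with step-up p∈ d≤1 m i
        ... | e′ , m′ , eq = e′ , m′ , sym (moved j (ℓ p + d) e′ e (sym eq))

      -- The two cells have the same marker. `step-down` produces a position from which the second
      -- cell reaches it, and `off-injective` identifies that position with the one assigned by the
      -- tiling.
      shift-element : ∀ {p d} → p ∈ ps → d ≤ 1 → ∀ j →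
        edge (element j) ≡ false → edge (element (j + (ℓ p + d))) ≡ false →
        ℓ p + d + off (element (j + (ℓ p + d))) ≡ off (element j)
        × product (element j) ≡ p * product (element (j + (ℓ p + d)))
      shift-element {p} {d} p∈ d≤1 j i i′ with step-down p∈ d≤1 (element∈ j) i
      ... | e′ , e′∈ , eq , prod
        with off-injective ((j + (ℓ p + d)) % Q) e′∈ (element∈ (j + (ℓ p + d)))
               (trans (moved j (ℓ p + d) (element j) e′ eq) (consistent p∈ d≤1 j i i′))
      ...   | same = trans (cong (λ e → ℓ p + d + off e) (sym same)) eq
                   , trans prod (cong (λ e → p * product e) same)

      element-period : ∀ j → element (j + Q) ≡ element j
      element-period j = cong el ([m+n]%n≡m%n j Q)

      labelAt : ℕ → ℕ
      labelAt j = marker j % Q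

      signAt : ℕ → Bool
      signAt j = u (product (element j)) xor odd (marker j / Q)

      labelAt-period : ∀ j → labelAt (j + Q) ≡ labelAt j
      labelAt-period j = trans (cong (λ e → (j + Q + off e) % Q) (element-period j))
        (trans (cong (_% Q) (swap j Q _)) ([m+n]%n≡m%n (marker j) Q))
        where
        swap : ∀ a b c → a + b + c ≡ a + c + b
        swap = solve-∀

      signAt-period : ∀ j → signAt (j + Q) ≡ not (signAt j)
      signAt-period j = trans (cong (λ e → u (product e) xor odd ((j + Q + off e) / Q)) (element-period j))
        (trans (cong (u (product (element j)) xor_) (cong odd quotient)) (xor-not (u (product (element j))) _))
        where
        swap : ∀ a b c → a + b + c ≡ b + (a + c)
        swap = solve-∀
        quotient : (j + Q + off (element j)) / Q ≡ suc (marker j / Q)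
        quotient = trans (cong (_/ Q) (swap j Q _)) (trans (m/n≡1+[m∸n]/n (m≤m+n Q (marker j)))
          (cong (λ z → suc (z / Q)) (m+n∸m≡n Q (marker j))))
        xor-not : ∀ a b → a xor not b ≡ not (a xor b)
        xor-not false b = refl
        xor-not true  b = refl

      shifted-edges : ℕ → ℕ → ℕ
      shifted-edges x p = ∑ (range 0 2) (λ d → edgeAt ((x + (ℓ p + d)) % Q))

      -- Flags cells at the edge of their tile, or brought there by some `p` up to `K` under either
      -- rounding `d`. Ranging over all such numbers rather than the primes gives `1 + shifts`
      -- terms, the factor built into `R`.
      badAt : ℕ → ℕ
      badAt x = edgeAt x + ∑ (range 0 (suc K)) (shifted-edges x)

      badAt-sparse : 4 * suc K * ∑ (range 0 Q) badAt ≤ Q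
      badAt-sparse = begin
        4 * suc K * ∑ (range 0 Q) badAt
          ≤⟨ *-monoʳ-≤ (4 * suc K) total ⟩
        4 * suc K * ((1 + shifts) * ∑ (range 0 Q) edgeAt)
          ≡⟨ trans (cong (_* ∑ (range 0 Q) edgeAt) R-def) (*-assoc (4 * suc K) (1 + shifts) (∑ (range 0 Q) edgeAt)) ⟨
        R * ∑ (range 0 Q) edgeAt
          ≤⟨ few-edge-cells ⟩
        Q ∎
        where
        open ≤-Reasoning
        total : ∑ (range 0 Q) badAt ≤ (1 + shifts) * ∑ (range 0 Q) edgeAt
        total = begin
          ∑ (range 0 Q) badAt
            ≡⟨ ∑-distrib-+ (range 0 Q) edgeAt _ ⟩
          ∑ (range 0 Q) edgeAt + ∑ (range 0 Q) (λ x → ∑ (range 0 (suc K)) (shifted-edges x))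
            ≡⟨ cong (∑ (range 0 Q) edgeAt +_) (∑-swap (range 0 Q) (range 0 (suc K)) _) ⟩
          ∑ (range 0 Q) edgeAt + ∑ (range 0 (suc K)) (λ p → ∑ (range 0 Q) (λ x → shifted-edges x p))
            ≤⟨ +-monoʳ-≤ (∑ (range 0 Q) edgeAt) (∑-bound (range 0 (suc K)) _ (λ p _ → ≤-trans
                 (≤-reflexive (∑-swap (range 0 Q) (range 0 2) (λ x d → edgeAt ((x + (ℓ p + d)) % Q))))
                 (∑-bound (range 0 2) _ (λ d _ → ∑-shift Q (ℓ p + d) edgeAt)))) ⟩
          ∑ (range 0 Q) edgeAt + length (range 0 (suc K)) * (2 * ∑ (range 0 Q) edgeAt)
            ≡⟨ cong (λ z → ∑ (range 0 Q) edgeAt + z * (2 * ∑ (range 0 Q) edgeAt)) (length-range 0 (suc K)) ⟩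
          ∑ (range 0 Q) edgeAt + suc K * (2 * ∑ (range 0 Q) edgeAt)
            ≡⟨ collect (suc K) (∑ (range 0 Q) edgeAt) ⟩
          (1 + shifts) * ∑ (range 0 Q) edgeAt ∎
          where
          collect : ∀ k e → e + k * (2 * e) ≡ (1 + k * 2) * e
          collect = solve-∀

      good : ∀ {p d} j → p ≤ K → d ≤ 1 → badAt (j % Q) ≡ 0 →
             edge (element j) ≡ false × edge (element (j + (ℓ p + d))) ≡ false
      good {p} {d} j p≤K d≤1 eq = edgeAt≡0 j (m+n≡0⇒m≡0 _ eq)
        , edgeAt≡0 (j + (ℓ p + d)) (trans (cong edgeAt (sym ([m%d+n]%d j (ℓ p + d) Q)))
            (∑≡0 (range 0 2) (λ d → edgeAt ((j % Q + (ℓ p + d)) % Q))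
              (∑≡0 (range 0 (suc K)) (shifted-edges (j % Q)) (m+n≡0⇒n≡0 (edgeAt (j % Q)) eq) (∈-range⁺ z≤n (s≤s p≤K)))
              (∈-range⁺ z≤n (s≤s d≤1))))

      -- The markers agree before reduction modulo `Q`, so the label and the number of completed
      -- turns are both preserved.
      marker-shift : ∀ {p d} j → p ∈ ps → p ≤ K → d ≤ 1 → badAt (j % Q) ≡ 0 →
        marker (j + (ℓ p + d)) ≡ marker j × product (element j) ≡ p * product (element (j + (ℓ p + d)))
      marker-shift {p} {d} j p∈ p≤K d≤1 eq with good {p} {d} j p≤K d≤1 eq
      ... | i , i′ with shift-element p∈ d≤1 j i i′
      ...   | o , q = trans (+-assoc j (ℓ p + d) _) (cong (j +_) o) , q

      ℓ-prime : ∀ {p n} → Prime p → 0 < n → ∃ λ d → d ≤ 1 × ℓ (p * n) ≡ ℓ n + (ℓ p + d)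
      ℓ-prime {p} {n} pr n>0 with ℓ-* (>-nonZero⁻¹ p {{prime⇒nonZero pr}}) n>0
      ... | d , d≤1 , eq = d , d≤1 , trans eq (swap (ℓ p) (ℓ n) d)
        where
        swap : ∀ a b c → a + b + c ≡ b + (a + c)
        swap = solve-∀

      ℓ-double : ∀ {n} → 0 < n → ℓ (2 * n) ≡ ℓ n + Q
      ℓ-double {n} n>0 = trans (ℓ-2^* 1 n>0) (trans (cong (_+ ℓ n) (+-identityʳ Q)) (+-comm Q (ℓ n)))

      label-invariant : ∀ {p n} → Prime p → p ≤ K → 0 < n → badAt (ℓ n % Q) ≡ 0 →
                        labelAt (ℓ (p * n)) ≡ labelAt (ℓ n)
      label-invariant {p} {n} pr p≤K n>0 eq with p ≟ 2
      ... | yes refl = trans (cong labelAt (ℓ-double n>0)) (labelAt-period (ℓ n))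
      ... | no p≢2 with ℓ-prime pr n>0
      ...   | d , d≤1 , e = trans (cong labelAt e)
              (cong (_% Q) (proj₁ (marker-shift (ℓ n) (∈-ps pr p≢2 p≤K) p≤K d≤1 eq)))

      sign-equivariant : ∀ {p n} → Prime p → p ≤ K → 0 < n → badAt (ℓ n % Q) ≡ 0 →
                         signAt (ℓ (p * n)) ≡ u p xor signAt (ℓ n)
      sign-equivariant {p} {n} pr p≤K n>0 eq with p ≟ 2
      -- `u 2` evaluates to `true`, so the factor `u p` is the `not` of `signAt-period`.
      ... | yes refl = trans (cong signAt (ℓ-double n>0)) (signAt-period (ℓ n))
      ... | no p≢2 with ℓ-prime pr n>0
      ...   | d , d≤1 , e with marker-shift (ℓ n) (∈-ps pr p≢2 p≤K) p≤K d≤1 eq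
      ...     | mk , prod = trans (cong signAt e) (trans (cong (λ z → u (product e′) xor odd (z / Q)) mk)
                (xor-solve (u (product (element (ℓ n)))) (u p) _ (u (product e′))
                  (trans (cong u prod) (u-* p (product e′) (>-nonZero⁻¹ p {{prime⇒nonZero pr}}) (product>0 e′)))))
        where
        e′ = element (ℓ n + (ℓ p + d))

      -- For each position of the box only one cell has the marker `y`.
      label-sparse : ∀ y → 4 * suc K * ∑ (range 0 Q) (λ x → δ (at x (el x)) y) ≤ Q
      label-sparse y = ≤-trans (*-monoʳ-≤ (4 * suc K) few) volume≤Q
        where
        open ≤-Reasoning
        few : ∑ (range 0 Q) (λ x → δ (at x (el x)) y) ≤ volume
        few = begin
          ∑ (range 0 Q) (λ x → δ (at x (el x)) y)
            ≤⟨ ∑-mono (range 0 Q) (λ x m → ∑-term shape (λ e → δ (at x e) y)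
                 (el∈ (proj₂ (∈-range⁻ m)))) ⟩
          ∑ (range 0 Q) (λ x → ∑ shape (λ e → δ (at x e) y))
            ≡⟨ ∑-swap (range 0 Q) shape _ ⟩
          ∑ shape (λ e → ∑ (range 0 Q) (λ x → δ (at x e) y))
            ≤⟨ ∑-bound shape 1 (λ e _ → ≤-trans (∑-shift Q (off e) (λ z → δ z y))
                 (∑-unique (range-unique 0 Q) (λ z → δ≤1 z y) (λ _ _ p q → trans (δ>0 p) (sym (δ>0 q))))) ⟩
          length shape * 1
            ≡⟨ trans (*-identityʳ _) (length-box dim) ⟩
          volume ∎

      open BlockSums Q

      stage : Stage K
      stage = record
        { period           = Q
        ; index            = ℓ
        ; label            = λ n → labelAt (ℓ n)
        ; sign             = λ n → signAt (ℓ n)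
        ; bad              = λ n → badAt (ℓ n % Q)
        ; index-mono       = ℓ-mono
        ; index-block      = λ s → trans (ℓ-2^ (suc s)) (cong (Q +_) (sym (ℓ-2^ s)))
        ; label-index      = cong labelAt
        ; sign-index       = cong signAt
        ; label<period     = λ n → m%n<n (marker (ℓ n)) Q
        ; label-invariant  = label-invariant
        ; sign-equivariant = sign-equivariant
        ; bad-rare         = block-rare (suc K) badAt badAt-sparse
        ; label-rare       = λ s y Q≤ → ≤-trans
            (≤-reflexive (cong (suc K *_) (∑-cong (block s) (λ n _ → cong (λ z → δ z y) (sym (at-% (ℓ n) (element (ℓ n))))))))
            (block-rare (suc K) (λ x → δ (at x (el x)) y) (label-sparse y) s Q≤)
        }

    stage : Stage K
    stage = from-tiling (Tiling.tiling Q shape off edge (replicate dim 0) (box-unique dim) off-injective R few-edges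
                          (subst (0 <_) (sym (length-box dim)) volume>0))
      where
      from-tiling : ∃ (λ (el : ℕ → Vec ℕ dim) → (∀ {x} → x < Q → el x ∈ shape) × Consistent el ×
                      R * ∑ (range 0 Q) (λ x → 𝟙 (edge (el x))) ≤ Q) → Stage K
      from-tiling (el , el∈ , el-consistent , few) = Tiled.stage el el∈ el-consistent few

  stages : ∀ K → Stage K
  stages K = Construction.stage K ps primes odds distinct complete R M Q {{Q-nonZero}} M>0 refl refl
               (m≤m+n (M * bound) _) (m≤n+m _ (M * bound))
    where
    ps : List ℕ
    ps = filter oddPrime? (upTo (suc K))
    primes : All Prime ps
    primes = All.tabulate (λ m → proj₁ (proj₂ (∈-filter⁻ oddPrime? {xs = upTo (suc K)} m)))
    odds : All (2 ≢_) ps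
    odds = All.tabulate (λ m e → proj₂ (proj₂ (∈-filter⁻ oddPrime? {xs = upTo (suc K)} m)) (sym e))
    distinct : Unique ps
    distinct = filter⁺ oddPrime? (upTo⁺ (suc K))
    complete : ∀ {p} → Prime p → p ≢ 2 → p ≤ K → p ∈ ps
    complete pr p≢2 p≤K = ∈-filter⁺ oddPrime? (∈-upTo⁺ (s≤s p≤K)) (pr , p≢2)
    -- `R` is the product of the sparsity `4 * suc K` asked for by `block-rare` and the number of
    -- shifts in `badAt`. `M` makes the two faces in each of the `suc (length ps)` directions at
    -- most an R-th of the box. The summands of `Q` serve to separate the values of `ℓ` and to make
    -- each label rare.
    R M bound volume Q : ℕ
    R      = 4 * suc K * (1 + suc K * 2)
    M      = 2 * suc (length ps) * R
    bound  = value ps (replicate _ M)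
    volume = M ^ suc (length ps)
    Q      = M * bound + 4 * suc K * volume
    M>0 : 0 < M
    M>0 = *-mono-≤ {1} {2 * suc (length ps)} {1} {R} (s≤s z≤n) (s≤s z≤n)
    Q-nonZero : NonZero Q
    Q-nonZero = >-nonZero (≤-trans (*-mono-≤ {1} {4 * suc K} {1} {volume} (s≤s z≤n) (^>0 M (suc (length ps)) M>0))
                            (m≤n+m _ (M * bound)))

  -- Null functions

  Null : (ℕ → ℕ) → Set
  Null f = ∀ K → ∃ λ N₀ → ∀ N → N₀ ≤ N → K * ∑ (range 1 N) f ≤ N

  Null-mono : ∀ {f g} → (∀ n → 0 < n → f n ≤ g n) → Null g → Null f
  Null-mono f≤g null K with null K
  ... | N₀ , h = N₀ , λ N N₀≤N → ≤-trans (*-monoʳ-≤ K (∑-mono (range 1 N) (λ n m → f≤g n (proj₁ (∈-range⁻ m))))) (h N N₀≤N)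

  Null-+ : ∀ {f g} → Null f → Null g → Null (λ n → f n + g n)
  Null-+ {f} {g} nullf nullg K with nullf (2 * K) | nullg (2 * K)
  ... | N₁ , h₁ | N₂ , h₂ = N₁ + N₂ , λ N le → *-cancelˡ-≤ 2 (begin
      2 * (K * ∑ (range 1 N) (λ n → f n + g n))             ≡⟨ cong (λ z → 2 * (K * z)) (∑-distrib-+ (range 1 N) f g) ⟩
      2 * (K * (∑ (range 1 N) f + ∑ (range 1 N) g))         ≡⟨ expand K _ _ ⟩
      2 * K * ∑ (range 1 N) f + 2 * K * ∑ (range 1 N) g     ≤⟨ +-mono-≤ (h₁ N (≤-trans (m≤m+n N₁ N₂) le)) (h₂ N (≤-trans (m≤n+m N₂ N₁) le)) ⟩
      N + N                                                 ≡⟨ cong (N +_) (+-identityʳ N) ⟨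
      2 * N                                                 ∎)
    where
    open ≤-Reasoning
    expand : ∀ k a b → 2 * (k * (a + b)) ≡ 2 * k * a + 2 * k * b
    expand = solve-∀

  ∑-range-suc-arg : ∀ a n f → ∑ (range a n) (λ x → f (suc x)) ≡ ∑ (range (suc a) n) f
  ∑-range-suc-arg a zero    f = refl
  ∑-range-suc-arg a (suc n) f = cong (f (suc a) +_) (∑-range-suc-arg (suc a) n f)

  Null-suc : ∀ {f} → Null f → Null (λ n → f (suc n))
  Null-suc {f} null K with null (2 * K)
  ... | N₀ , h = suc N₀ , λ N le → *-cancelˡ-≤ 2 (begin
      2 * (K * ∑ (range 1 N) (λ n → f (suc n)))    ≡⟨ cong (λ z → 2 * (K * z)) (∑-range-suc-arg 1 N f) ⟩
      2 * (K * ∑ (range 2 N) f)                    ≡⟨ *-assoc 2 K _ ⟨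
      2 * K * ∑ (range 2 N) f                      ≤⟨ *-monoʳ-≤ (2 * K) (m≤n+m _ (f 1)) ⟩
      2 * K * ∑ (range 1 (suc N)) f                ≤⟨ h (suc N) (≤-trans (n≤1+n N₀) (≤-trans le (n≤1+n N))) ⟩
      1 + N                                        ≤⟨ +-monoˡ-≤ N (≤-trans (s≤s z≤n) le) ⟩
      N + N                                        ≡⟨ cong (N +_) (+-identityʳ N) ⟨
      2 * N                                        ∎)
    where open ≤-Reasoning

  -- The left side is the part of the right side over the multiples of `suc q`.
  ∑-dilate : ∀ q N (f : ℕ → ℕ) → ∑ (range 1 N) (λ n → f (suc q * n)) ≤ ∑ (range 1 (suc q * N)) f
  ∑-dilate q zero f = z≤n
  ∑-dilate q (suc N) f = begin
    ∑ (range 1 (suc N)) (λ n → f (p * n))                   ≡⟨ ∑-range-suc 1 N _ ⟩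
    ∑ (range 1 N) (λ n → f (p * n)) + f (p * suc N)         ≤⟨ +-mono-≤ (∑-dilate q N f) last ⟩
    ∑ (range 1 (p * N)) f + ∑ (range (1 + p * N) p) f       ≡⟨ ∑-range-+ 1 (p * N) p f ⟨
    ∑ (range 1 (p * N + p)) f                               ≡⟨ cong (λ k → ∑ (range 1 k) f) (trans (+-comm (p * N) p) (sym (*-suc p N))) ⟩
    ∑ (range 1 (p * suc N)) f                               ∎
    where
    open ≤-Reasoning
    p = suc q
    reindex : ∀ q N → suc q * suc N ≡ 1 + suc q * N + q
    reindex = solve-∀
    last : f (p * suc N) ≤ ∑ (range (1 + p * N) p) f
    last = subst (λ k → f k ≤ ∑ (range (1 + p * N) p) f) (sym (reindex q N))
      (≤-trans (m≤n+m _ _) (≤-reflexive (sym (∑-range-suc (1 + p * N) q f))))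

  Null-dilate : ∀ {f} p → 0 < p → Null f → Null (λ n → f (p * n))
  Null-dilate {f} p@(suc q) _ null K with null (K * p)
  ... | N₀ , h = N₀ , λ N le → *-cancelˡ-≤ p (begin
      p * (K * ∑ (range 1 N) (λ n → f (p * n)))   ≡⟨ rearrange p K _ ⟩
      K * p * ∑ (range 1 N) (λ n → f (p * n))     ≤⟨ *-monoʳ-≤ (K * p) (∑-dilate q N f) ⟩
      K * p * ∑ (range 1 (p * N)) f               ≤⟨ h (p * N) (≤-trans le (m≤m+n N (q * N))) ⟩
      p * N                                       ∎)
    where
    open ≤-Reasoning
    rearrange : ∀ p k x → p * (k * x) ≡ k * p * x
    rearrange = solve-∀

  -- A geometric series: the blocks from `s₀` on have total length less than `2 ^ (i + s₀)`.
  ∑-blocks : ∀ K f s₀ → (∀ s → s₀ ≤ s → K * ∑ (block s) f ≤ 2 ^ s) → ∀ i →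
             K * ∑ (range 0 (2 ^ (i + s₀))) f ≤ K * ∑ (range 0 (2 ^ s₀)) f + 2 ^ (i + s₀)
  ∑-blocks K f s₀ h zero    = m≤m+n _ _
  ∑-blocks K f s₀ h (suc i) = begin
    K * ∑ (range 0 (2 * len)) f                           ≡⟨ cong (λ k → K * ∑ (range 0 (len + k)) f) (+-identityʳ len) ⟩
    K * ∑ (range 0 (len + len)) f                           ≡⟨ cong (K *_) (∑-range-+ 0 len len f) ⟩
    K * (∑ (range 0 len) f + ∑ (block (i + s₀)) f)        ≡⟨ *-distribˡ-+ K _ _ ⟩
    K * ∑ (range 0 len) f + K * ∑ (block (i + s₀)) f      ≤⟨ +-mono-≤ (∑-blocks K f s₀ h i) (h (i + s₀) (m≤n+m s₀ i)) ⟩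
    K * ∑ (range 0 (2 ^ s₀)) f + len + len                  ≡⟨ collect _ len ⟩
    K * ∑ (range 0 (2 ^ s₀)) f + 2 * len                  ∎
    where
    open ≤-Reasoning
    len = 2 ^ (i + s₀)
    collect : ∀ x b → x + b + b ≡ x + 2 * b
    collect = solve-∀

  -- Rounding `N` up to a power of 2 at most doubles it, and for large `N` the initial segment costs
  -- at most another `N`; using the block bound for `4 * K` leaves room for both.
  Null-blocks : ∀ {f} → (∀ K → ∃ λ s₀ → ∀ s → s₀ ≤ s → K * ∑ (block s) f ≤ 2 ^ s) → Null f
  Null-blocks {f} h K with h (4 * K)
  ... | s₀ , hs = 2 ^ s₀ + 4 * K * initial , λ N le → *-cancelˡ-≤ 4 (bound N le)
    where
    open ≤-Reasoning
    initial = ∑ (range 0 (2 ^ s₀)) f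
    four : ∀ k x → 4 * (k * x) ≡ 4 * k * x
    four = solve-∀
    collect : ∀ n → n + 2 * n + n ≡ 4 * n
    collect = solve-∀
    bound : ∀ N → 2 ^ s₀ + 4 * K * initial ≤ N → 4 * (K * ∑ (range 1 N) f) ≤ 4 * N
    bound N le = begin
      4 * (K * ∑ (range 1 N) f)                     ≡⟨ four K _ ⟩
      4 * K * ∑ (range 1 N) f                       ≤⟨ *-monoʳ-≤ (4 * K) (m≤n+m _ (f 0)) ⟩
      4 * K * ∑ (range 0 (suc N)) f                 ≤⟨ *-monoʳ-≤ (4 * K) (∑-range-mono 0 f (n<2^1+⌊log₂n⌋ N)) ⟩
      4 * K * ∑ (range 0 (2 ^ s)) f                 ≡⟨ cong (λ k → 4 * K * ∑ (range 0 (2 ^ k)) f) (m∸n+n≡m s₀≤s) ⟨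
      4 * K * ∑ (range 0 (2 ^ (s ∸ s₀ + s₀))) f     ≤⟨ ∑-blocks (4 * K) f s₀ hs (s ∸ s₀) ⟩
      4 * K * initial + 2 ^ (s ∸ s₀ + s₀)                 ≡⟨ cong (λ k → 4 * K * initial + 2 ^ k) (m∸n+n≡m s₀≤s) ⟩
      4 * K * initial + 2 ^ s                             ≤⟨ +-mono-≤ (≤-trans (m≤n+m _ (2 ^ s₀)) le)
                                                                (*-monoʳ-≤ 2 (2^⌊log₂n⌋≤n N>0)) ⟩
      N + 2 * N                                     ≤⟨ m≤m+n _ N ⟩
      N + 2 * N + N                                 ≡⟨ collect N ⟩
      4 * N                                         ∎
      where
      s = suc ⌊log₂ N ⌋
      2^s₀≤N : 2 ^ s₀ ≤ N
      2^s₀≤N = ≤-trans (m≤m+n _ _) le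
      N>0 : 0 < N
      N>0 = ≤-trans (^>0 2 s₀ (s≤s z≤n)) 2^s₀≤N
      s₀≤s : s₀ ≤ s
      s₀≤s = ≤-trans (2^k≤n⇒k≤⌊log₂n⌋ 2^s₀≤N) (n≤1+n _)

  count-∑ : ∀ A N → count A N ≡ ∑ (range 1 N) (λ n → 𝟙 (A n))
  count-∑ A zero    = refl
  count-∑ A (suc N) = trans (+-comm (𝟙 (A (suc N))) (count A N))
    (trans (cong (_+ 𝟙 (A (suc N))) (count-∑ A N)) (sym (∑-range-suc 1 N (λ n → 𝟙 (A n)))))

  -- Exponential against polynomial growth

  n<2^n : ∀ n → n < 2 ^ n
  n<2^n zero    = s≤s z≤n
  n<2^n (suc n) = +-mono-≤ {1} (^>0 2 n (s≤s z≤n)) (≤-trans (n<2^n n) (≤-reflexive (sym (+-identityʳ _))))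

  square-step : ∀ K x → 3 ≤ x → K * (x * x) ≤ 2 ^ x → K * (suc x * suc x) ≤ 2 ^ suc x
  square-step K x x≥3 h = begin
    K * (suc x * suc x)            ≡⟨ cong (K *_) (expand x) ⟩
    K * (x * x + (2 * x + 1))      ≤⟨ *-monoʳ-≤ K (+-monoʳ-≤ (x * x) (≤-trans (+-monoʳ-≤ (2 * x) (≤-trans (s≤s z≤n) x≥3))
                                        (≤-trans (≤-reflexive (three x)) (*-monoˡ-≤ x x≥3)))) ⟩
    K * (x * x + x * x)            ≡⟨ double K (x * x) ⟩
    2 * (K * (x * x))              ≤⟨ *-monoʳ-≤ 2 h ⟩
    2 ^ suc x                      ∎
    where
    open ≤-Reasoning
    expand : ∀ x → suc x * suc x ≡ x * x + (2 * x + 1)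
    expand = solve-∀
    three : ∀ x → 2 * x + x ≡ 3 * x
    three = solve-∀
    double : ∀ k y → k * (y + y) ≡ 2 * (k * y)
    double = solve-∀

  -- Taking `x` to be a power of 2 and bounding `k` by `2 ^ k` reduces the claim to an inequality
  -- between exponents; the 4 makes that inequality hold for every `k`.
  square-base : ∀ k → k * (2 ^ (k + 4) * 2 ^ (k + 4)) ≤ 2 ^ (2 ^ (k + 4))
  square-base k = begin
    k * (2 ^ j * 2 ^ j)            ≤⟨ *-monoˡ-≤ _ (<⇒≤ (n<2^n k)) ⟩
    2 ^ k * (2 ^ j * 2 ^ j)        ≡⟨ cong (2 ^ k *_) (^-distribˡ-+-* 2 j j) ⟨
    2 ^ k * 2 ^ (j + j)            ≡⟨ ^-distribˡ-+-* 2 k (j + j) ⟨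
    2 ^ (k + (j + j))              ≤⟨ ^-monoʳ-≤ 2 exponent ⟩
    2 ^ (2 ^ j)                    ∎
    where
    open ≤-Reasoning
    j = k + 4
    split : ∀ k → k + (k + 4 + (k + 4)) + (13 * k + 8) ≡ suc k * 16
    split = solve-∀
    exponent : k + (j + j) ≤ 2 ^ j
    exponent = begin
      k + (j + j)                   ≤⟨ m≤m+n _ (13 * k + 8) ⟩
      k + (j + j) + (13 * k + 8)    ≡⟨ split k ⟩
      suc k * 16                    ≤⟨ *-monoˡ-≤ 16 (n<2^n k) ⟩
      2 ^ k * 16                    ≡⟨ ^-distribˡ-+-* 2 k 4 ⟨
      2 ^ j                         ∎

  -- Squares are the relevant growth: the block at `2 ^ s` has O(s) sign changes, and each costs a
  -- partial sum of `u` of size O(s).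
  square≤2^ : ∀ K → ∃ λ x₀ → ∀ x → x₀ ≤ x → K * (x * x) ≤ 2 ^ x
  square≤2^ K = 2 ^ (K + 4) , λ x le → subst (λ z → K * (z * z) ≤ 2 ^ z) (m∸n+n≡m le) (from (x ∸ 2 ^ (K + 4)))
    where
    base≥3 : 3 ≤ 2 ^ (K + 4)
    base≥3 = ≤-trans (s≤s (s≤s (s≤s z≤n))) (≤-trans (^-monoʳ-≤ 2 {4} (m≤n+m 4 K)) ≤-refl)
    from : ∀ i → K * ((i + 2 ^ (K + 4)) * (i + 2 ^ (K + 4))) ≤ 2 ^ (i + 2 ^ (K + 4))
    from zero    = square-base K
    from (suc i) = square-step K _ (≤-trans base≥3 (m≤n+m _ i)) (from i)

  shifted-square≤2^ : ∀ K C → ∃ λ s₀ → ∀ s → s₀ ≤ s → K * ((s + C) * (s + C)) ≤ 2 ^ s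
  shifted-square≤2^ K C with square≤2^ (2 ^ C * K)
  ... | x₀ , h = x₀ , λ s le → *-cancelˡ-≤ (2 ^ C) {{>-nonZero (^>0 2 C (s≤s z≤n))}} (begin
      2 ^ C * (K * ((s + C) * (s + C)))    ≡⟨ *-assoc (2 ^ C) K _ ⟨
      2 ^ C * K * ((s + C) * (s + C))      ≤⟨ h (s + C) (≤-trans le (m≤m+n s C)) ⟩
      2 ^ (s + C)                          ≡⟨ trans (cong (2 ^_) (+-comm s C)) (^-distribˡ-+-* 2 C s) ⟩
      2 ^ C * 2 ^ s                        ∎)
    where open ≤-Reasoning

  log-negligible : ∀ K → ∃ λ N₀ → ∀ N → N₀ ≤ N → K * suc ⌊log₂ N ⌋ ≤ N
  log-negligible K with shifted-square≤2^ K 1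
  ... | s₀ , h = 2 ^ s₀ , λ N le → begin
      K * suc ⌊log₂ N ⌋
        ≡⟨ cong (K *_) (+-comm 1 ⌊log₂ N ⌋) ⟩
      K * (⌊log₂ N ⌋ + 1)
        ≤⟨ *-monoʳ-≤ K (≤-trans (≤-reflexive (sym (*-identityʳ _))) (*-monoʳ-≤ (⌊log₂ N ⌋ + 1) (m≤n+m 1 ⌊log₂ N ⌋))) ⟩
      K * ((⌊log₂ N ⌋ + 1) * (⌊log₂ N ⌋ + 1))
        ≤⟨ h ⌊log₂ N ⌋ (2^k≤n⇒k≤⌊log₂n⌋ le) ⟩
      2 ^ ⌊log₂ N ⌋
        ≤⟨ 2^⌊log₂n⌋≤n (≤-trans (^>0 2 s₀ (s≤s z≤n)) le) ⟩
      N ∎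
    where open ≤-Reasoning

-- Natural density by integer inequalities

module Densities where

  open Arithmetic
  open import Data.Bool using (Bool; true; false; not; _∧_; _xor_)
  open import Data.Integer as ℤ using (ℤ; +_; -[1+_]; +[1+_]; ∣_∣; _+_; _*_; -_; _-_; 0ℤ; 1ℤ; -1ℤ)
  import Data.Integer.Properties as ℤ
  open import Data.Integer.Tactic.RingSolver using (solve-∀)
  open import Data.Nat as ℕ using (ℕ; zero; suc; z≤n; s≤s; _≤_; _<_)
  open import Data.Nat.DivMod using (_/_; _%_; m≡m%n+[m/n]*n; m%n<n; [m+kn]%n≡m%n; m<n*o⇒m/o<n)
  open import Data.Nat.Logarithm using (⌊log₂_⌋)
  open import Data.Nat.Primality using (Prime; prime⇒nonZero)
  import Data.Nat.Properties as ℕ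
  import Data.Nat.Tactic.RingSolver as ℕ-Solver
  open import Data.Product using (∃; _×_; _,_)
  open import Data.Rational as ℚ using (ℚ; mkℚ; 0ℚ; ½; ↥_; ↧_; ↧ₙ_; toℚᵘ)
  import Data.Rational.Properties as ℚ
  open import Data.Rational.Unnormalised as ℚᵘ using (mkℚᵘ; *<*; _≃_)
  import Data.Rational.Unnormalised.Properties as ℚᵘ
  open import Relation.Binary.PropositionalEquality
  open import Relation.Nullary using (¬_; contradiction)

  -- For positive `N`, the distance of `count A N / N` from `δ`, multiplied by `N` and the
  -- denominator of `δ`; this makes it an integer.
  deviation : NSet → ℚ → ℕ → ℕ
  deviation A δ N = ∣ + count A N * ↧ δ + - (↥ δ) * + N ∣

  density : ∀ A δ → (∀ K → ∃ λ N₀ → ∀ N → N₀ ≤ N → K ℕ.* deviation A δ N ≤ N) → HasDensity A δ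
  density A δ@(mkℚ _ _ _) h ε ε>0 with ε | ℚ.positive ε>0
  -- The denominator of `ε` is `suc b`; asking for one more turns the weak inequality of the
  -- hypothesis into a strict one.
  ... | ε′@(mkℚ +[1+ a ] b _) | _ with h (suc (suc b))
  ...   | N₀ , small = N₀ , λ m N₀≤m → ℚ.toℚᵘ-cancel-< (ℚᵘ.<-respˡ-≃ (ℚᵘ.≃-sym (unnormalise m))
            (*<* (compare m (small (suc m) (ℕ.≤-trans N₀≤m (ℕ.n≤1+n m))))))
    where
    unnormalise : ∀ m → toℚᵘ (ℚ.∣ (+ count A (suc m)) ℚ./ suc m ℚ.- δ ∣) ≃
                        ℚᵘ.∣ mkℚᵘ (+ count A (suc m)) m ℚᵘ.+ ℚᵘ.- toℚᵘ δ ∣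
    unnormalise m = ℚᵘ.≃-trans (ℚ.toℚᵘ-homo-∣-∣ (x ℚ.- δ)) (ℚᵘ.∣-∣-cong (ℚᵘ.≃-trans (ℚ.toℚᵘ-homo-+ x (ℚ.- δ))
        (ℚᵘ.+-cong (ℚ.toℚᵘ-fromℚᵘ (mkℚᵘ (+ count A (suc m)) m)) (ℚ.toℚᵘ-homo‿- δ))))
      where x = (+ count A (suc m)) ℚ./ suc m
    compare : ∀ m → suc (suc b) ℕ.* deviation A δ (suc m) ≤ suc m →
      + ∣ + count A (suc m) * ↧ δ + - (↥ δ) * + suc m ∣ * + suc b ℤ.< +[1+ a ] * + (suc m ℕ.* ↧ₙ δ)
    compare m le = subst₂ ℤ._<_ (ℤ.pos-* d (suc b)) (ℤ.pos-* (suc a) (suc m ℕ.* ↧ₙ δ)) (ℤ.+<+ (begin-strict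
        d ℕ.* suc b                     ≡⟨ ℕ.*-comm d (suc b) ⟩
        suc b ℕ.* d                     <⟨ bounded d le ⟩
        suc m                           ≤⟨ ℕ.m≤m*n (suc m) (↧ₙ δ) ⟩
        suc m ℕ.* ↧ₙ δ                  ≤⟨ ℕ.m≤n*m (suc m ℕ.* ↧ₙ δ) (suc a) ⟩
        suc a ℕ.* (suc m ℕ.* ↧ₙ δ)      ∎))
      where
      open ℕ.≤-Reasoning
      d = deviation A δ (suc m)
      bounded : ∀ d → suc (suc b) ℕ.* d ≤ suc m → suc b ℕ.* d < suc m
      bounded zero    _ rewrite ℕ.*-zeroʳ b = s≤s z≤n
      bounded (suc d) q = ℕ.≤-trans (ℕ.+-monoˡ-≤ (suc b ℕ.* suc d) (s≤s (z≤n {d}))) q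

  Null⇒density-0 : ∀ A → Null (λ n → 𝟙 (A n)) → HasDensity A 0ℚ
  Null⇒density-0 A null = density A 0ℚ λ K → let N₀ , h = null K in N₀ , λ N le →
    ℕ.≤-trans (ℕ.≤-reflexive (cong (K ℕ.*_) (trans (simplify N) (count-∑ A N)))) (h N le)
    where
    simplify : ∀ N → deviation A 0ℚ N ≡ count A N
    simplify N = cong ∣_∣ (trans (cong₂ _+_ (ℤ.*-identityʳ (+ count A N)) (ℤ.*-zeroˡ (+ N))) (ℤ.+-identityʳ (+ count A N)))

  -- Partial sums and runs of the character

  sgn : Bool → ℤ
  sgn false = 1ℤ
  sgn true  = -1ℤ

  U : ℕ → ℤ
  U zero    = 0ℤ
  U (suc n) = U n + sgn (u (suc n))

  u-3n+1 : ∀ n → u (1 ℕ.+ 3 ℕ.* n) ≡ false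
  u-3n+1 n rewrite ℕ.*-comm 3 n = trans (u-residue (1 ℕ.+ n ℕ.* 3) (λ e → contradiction (trans (sym ([m+kn]%n≡m%n 1 n 3)) e) λ ()))
    (cong residue-sign ([m+kn]%n≡m%n 1 n 3))

  u-3n+2 : ∀ n → u (2 ℕ.+ 3 ℕ.* n) ≡ true
  u-3n+2 n rewrite ℕ.*-comm 3 n = trans (u-residue (2 ℕ.+ n ℕ.* 3) (λ e → contradiction (trans (sym ([m+kn]%n≡m%n 2 n 3)) e) λ ()))
    (cong residue-sign ([m+kn]%n≡m%n 2 n 3))

  U-3n+1 : ∀ n → U (1 ℕ.+ 3 ℕ.* n) ≡ U (3 ℕ.* n) + 1ℤ
  U-3n+1 n = cong (λ b → U (3 ℕ.* n) + sgn b) (u-3n+1 n)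

  U-3n+2 : ∀ n → U (2 ℕ.+ 3 ℕ.* n) ≡ U (3 ℕ.* n)
  U-3n+2 n = trans (cong₂ (λ x b → x + sgn b) (U-3n+1 n) (u-3n+2 n)) (cancel (U (3 ℕ.* n)))
    where
    cancel : ∀ x → x + 1ℤ + -1ℤ ≡ x
    cancel = solve-∀

  -- The values at 3k+1 and 3k+2 cancel, and those at the multiples of 3 reproduce the sequence.
  U-3n : ∀ n → U (3 ℕ.* n) ≡ U n
  U-3n zero    = refl
  U-3n (suc n) = begin
    U (3 ℕ.* suc n)                            ≡⟨ cong U (step n) ⟩
    U (2 ℕ.+ 3 ℕ.* n) + sgn (u (3 ℕ.+ 3 ℕ.* n)) ≡⟨ cong₂ _+_ (trans (U-3n+2 n) (U-3n n))
                                                   (cong sgn (trans (cong u (sym (step n))) (u-3* (suc n)))) ⟩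
    U n + sgn (u (suc n))                      ∎
    where
    open ≡-Reasoning
    step : ∀ n → 3 ℕ.* suc n ≡ 3 ℕ.+ 3 ℕ.* n
    step n = ℕ.*-suc 3 n

  ∣U∣-third : ∀ n → ∣ U n ∣ ≤ suc ∣ U (n / 3) ∣
  ∣U∣-third n = subst (λ k → ∣ U k ∣ ≤ suc ∣ U q ∣) (sym n≡) (residues (n % 3) (m%n<n n 3))
    where
    q = n / 3
    n≡ : n ≡ n % 3 ℕ.+ 3 ℕ.* q
    n≡ = trans (m≡m%n+[m/n]*n n 3) (cong (n % 3 ℕ.+_) (ℕ.*-comm q 3))
    residues : ∀ r → r < 3 → ∣ U (r ℕ.+ 3 ℕ.* q) ∣ ≤ suc ∣ U q ∣
    residues 0 _ = ℕ.≤-trans (ℕ.≤-reflexive (cong ∣_∣ (U-3n q))) (ℕ.n≤1+n _)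
    residues 1 _ = ℕ.≤-trans (ℕ.≤-reflexive (cong ∣_∣ (trans (U-3n+1 q) (cong (_+ 1ℤ) (U-3n q)))))
      (ℕ.≤-trans (ℤ.∣i+j∣≤∣i∣+∣j∣ (U q) 1ℤ) (ℕ.≤-reflexive (ℕ.+-comm ∣ U q ∣ 1)))
    residues 2 _ = ℕ.≤-trans (ℕ.≤-reflexive (cong ∣_∣ (trans (U-3n+2 q) (U-3n q)))) (ℕ.n≤1+n _)
    residues (suc (suc (suc _))) (s≤s (s≤s (s≤s ())))

  -- Each division by 3 costs at most one and takes a number below `2 ^ suc s` to one below `2 ^ s`.
  ∣U∣≤ : ∀ s n → n < 2 ℕ.^ s → ∣ U n ∣ ≤ s
  ∣U∣≤ zero    zero    _ = z≤n
  ∣U∣≤ zero    (suc n) (s≤s ())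
  ∣U∣≤ (suc s) n       lt = ℕ.≤-trans (∣U∣-third n) (s≤s (∣U∣≤ s (n / 3) (m<n*o⇒m/o<n {n} {2 ℕ.^ s} {3} (begin-strict
    n                 <⟨ lt ⟩
    2 ℕ.* 2 ℕ.^ s     ≤⟨ ℕ.*-monoˡ-≤ (2 ℕ.^ s) (s≤s (s≤s (z≤n {1}))) ⟩
    3 ℕ.* 2 ℕ.^ s     ≡⟨ ℕ.*-comm 3 (2 ℕ.^ s) ⟩
    2 ℕ.^ s ℕ.* 3     ∎))))
    where open ℕ.≤-Reasoning

  ∣U∣≤log : ∀ n → ∣ U n ∣ ≤ suc ⌊log₂ n ⌋
  ∣U∣≤log n = ∣U∣≤ (suc ⌊log₂ n ⌋) n (n<2^1+⌊log₂n⌋ n)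

  xor≡false⇒≡ : ∀ {a b} → a xor b ≡ false → a ≡ b
  xor≡false⇒≡ {false} {false} _ = refl
  xor≡false⇒≡ {true}  {true}  _ = refl

  not-both-equal : ∀ n → ¬ (u n ≡ u (1 ℕ.+ n) × u (1 ℕ.+ n) ≡ u (2 ℕ.+ n))
  not-both-equal n = subst (λ k → ¬ (u k ≡ u (1 ℕ.+ k) × u (1 ℕ.+ k) ≡ u (2 ℕ.+ k))) (sym n≡) (residues (n % 3) (m%n<n n 3))
    where
    q = n / 3
    n≡ : n ≡ n % 3 ℕ.+ 3 ℕ.* q
    n≡ = trans (m≡m%n+[m/n]*n n 3) (cong (n % 3 ℕ.+_) (ℕ.*-comm q 3))
    residues : ∀ r → r < 3 → let k = r ℕ.+ 3 ℕ.* q in ¬ (u k ≡ u (1 ℕ.+ k) × u (1 ℕ.+ k) ≡ u (2 ℕ.+ k))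
    residues 0 _ (_ , e) = contradiction (trans (sym (u-3n+1 q)) (trans e (u-3n+2 q))) λ ()
    residues 1 _ (e , _) = contradiction (trans (sym (u-3n+1 q)) (trans e (u-3n+2 q))) λ ()
    residues 2 _ (e , e′) = contradiction (trans (sym (u-3n+1 (suc q)))
      (trans (cong u (cong suc (ℕ.*-suc 3 q))) (trans (sym e′) (trans (sym e) (u-3n+2 q))))) λ ()
    residues (suc (suc (suc _))) (s≤s (s≤s (s≤s ())))

  -- Here `a`, `b` stand for changes of σ right after n, and `c`, `d` for those right after pn. When
  -- all four are absent, the two indicators reduce to `x` and `y`.
  edge-bound : ∀ x y a b c d → 𝟙 ((x ∧ (not a ∧ not b)) xor (y ∧ (not c ∧ not d))) ≤
                               𝟙 (x xor y) ℕ.+ (𝟙 a ℕ.+ 𝟙 b ℕ.+ (𝟙 c ℕ.+ 𝟙 d))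
  edge-bound x y true  b     c     d     = ℕ.≤-trans (𝟙≤1 _) (ℕ.≤-trans (s≤s z≤n) (ℕ.m≤n+m _ (𝟙 (x xor y))))
  edge-bound x y false true  c     d     = ℕ.≤-trans (𝟙≤1 _) (ℕ.≤-trans (s≤s z≤n) (ℕ.m≤n+m _ (𝟙 (x xor y))))
  edge-bound x y false false true  d     = ℕ.≤-trans (𝟙≤1 _) (ℕ.≤-trans (s≤s z≤n) (ℕ.m≤n+m _ (𝟙 (x xor y))))
  edge-bound x y false false false true  = ℕ.≤-trans (𝟙≤1 _) (ℕ.m≤n+m _ (𝟙 (x xor y)))
  edge-bound false false false false false false = z≤n
  edge-bound false true  false false false false = s≤s z≤n
  edge-bound true  false false false false false = s≤s z≤n
  edge-bound true  true  false false false false = z≤n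

  -- Read `v`, `s`, `q`, `t` as u(n), σ(n), u(p), σ(pn): the factor u(n) cancels, and what remains
  -- is the failure of equivariance of σ.
  twist-bound : ∀ v s q t → not (v xor s) xor not ((q xor v) xor t) ≡ t xor (q xor s)
  twist-bound false false false false = refl
  twist-bound false false false true  = refl
  twist-bound false false true  false = refl
  twist-bound false false true  true  = refl
  twist-bound false true  false false = refl
  twist-bound false true  false true  = refl
  twist-bound false true  true  false = refl
  twist-bound false true  true  true  = refl
  twist-bound true  false false false = refl
  twist-bound true  false false true  = refl
  twist-bound true  false true  false = refl
  twist-bound true  false true  true  = refl
  twist-bound true  true  false false = refl
  twist-bound true  true  false true  = refl
  twist-bound true  true  true  false = refl
  twist-bound true  true  true  true  = refl

  -- The set attached to a sign function

  module Twisted (σ : ℕ → Bool) where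

    change : ℕ → ℕ
    change n = 𝟙 (σ n xor σ (suc n))

    T : ℕ → ℤ
    T zero    = 0ℤ
    T (suc n) = T n + sgn (u (suc n) xor σ (suc n))

    switch-cost : ℕ → ℕ
    switch-cost n = change n ℕ.* ∣ U n ∣

    sgn-xor : ∀ a b → sgn (a xor b) ≡ sgn b * sgn a
    sgn-xor false false = refl
    sgn-xor false true  = refl
    sgn-xor true  false = refl
    sgn-xor true  true  = refl

    ∣sgn-sgn∣ : ∀ a b x → ∣ (sgn a - sgn b) * x ∣ ≤ 2 ℕ.* (𝟙 (a xor b) ℕ.* ∣ x ∣)
    ∣sgn-sgn∣ false false x = z≤n
    ∣sgn-sgn∣ false true  x = ℕ.≤-reflexive (trans (ℤ.abs-* (+ 2) x) (cong (2 ℕ.*_) (sym (ℕ.*-identityˡ ∣ x ∣))))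
    ∣sgn-sgn∣ true  false x = ℕ.≤-reflexive (trans (ℤ.abs-* (-[1+ 1 ]) x) (cong (2 ℕ.*_) (sym (ℕ.*-identityˡ ∣ x ∣))))
    ∣sgn-sgn∣ true  true  x = z≤n

    -- As long as σ is constant, `T n` and `sgn (σ n) * U n` have the same increments; a change of σ
    -- after `n` shifts their difference by twice `U n` in absolute value.
    summation-by-parts : ∀ n → ∣ T n - sgn (σ n) * U n ∣ ≤ 2 ℕ.* ∑ (range 0 n) switch-cost
    summation-by-parts zero    = ℕ.≤-reflexive (cong ∣_∣ (trans (ℤ.+-identityˡ _) (cong -_ (ℤ.*-zeroʳ (sgn (σ 0))))))
    summation-by-parts (suc n) = begin
      ∣ T n + sgn (u (suc n) xor σ (suc n)) - sgn (σ (suc n)) * (U n + sgn (u (suc n))) ∣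
        ≡⟨ cong (λ z → ∣ T n + z - sgn (σ (suc n)) * (U n + sgn (u (suc n))) ∣) (sgn-xor (u (suc n)) (σ (suc n))) ⟩
      ∣ T n + sgn (σ (suc n)) * sgn (u (suc n)) - sgn (σ (suc n)) * (U n + sgn (u (suc n))) ∣
        ≡⟨ cong ∣_∣ (split (T n) (sgn (σ n)) (sgn (σ (suc n))) (U n) (sgn (u (suc n)))) ⟩
      ∣ (T n - sgn (σ n) * U n) + (sgn (σ n) - sgn (σ (suc n))) * U n ∣
        ≤⟨ ℤ.∣i+j∣≤∣i∣+∣j∣ (T n - sgn (σ n) * U n) _ ⟩
      ∣ T n - sgn (σ n) * U n ∣ ℕ.+ ∣ (sgn (σ n) - sgn (σ (suc n))) * U n ∣
        ≤⟨ ℕ.+-mono-≤ (summation-by-parts n) (∣sgn-sgn∣ (σ n) (σ (suc n)) (U n)) ⟩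
      2 ℕ.* ∑ (range 0 n) switch-cost ℕ.+ 2 ℕ.* switch-cost n
        ≡⟨ ℕ.*-distribˡ-+ 2 (∑ (range 0 n) switch-cost) _ ⟨
      2 ℕ.* (∑ (range 0 n) switch-cost ℕ.+ switch-cost n)
        ≡⟨ cong (2 ℕ.*_) (∑-range-suc 0 n switch-cost) ⟨
      2 ℕ.* ∑ (range 0 (suc n)) switch-cost ∎
      where
      open ℕ.≤-Reasoning
      split : ∀ t a b v w → t + b * w - b * (v + w) ≡ (t - a * v) + (a - b) * v
      split = solve-∀

    ∣T∣≤ : ∀ n → ∣ T n ∣ ≤ suc ⌊log₂ n ⌋ ℕ.+ 2 ℕ.* ∑ (range 1 n) switch-cost
    ∣T∣≤ n = begin
      ∣ T n ∣                                                ≡⟨ cong ∣_∣ (split (T n) (sgn (σ n) * U n)) ⟩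
      ∣ sgn (σ n) * U n + (T n - sgn (σ n) * U n) ∣           ≤⟨ ℤ.∣i+j∣≤∣i∣+∣j∣ (sgn (σ n) * U n) _ ⟩
      ∣ sgn (σ n) * U n ∣ ℕ.+ ∣ T n - sgn (σ n) * U n ∣       ≤⟨ ℕ.+-mono-≤ (unit (σ n)) (ℕ.≤-trans (summation-by-parts n)
                                                                   (ℕ.*-monoʳ-≤ 2 (drop-zero n))) ⟩
      suc ⌊log₂ n ⌋ ℕ.+ 2 ℕ.* ∑ (range 1 n) switch-cost      ∎
      where
      open ℕ.≤-Reasoning
      split : ∀ t v → t ≡ v + (t - v)
      split = solve-∀
      unit : ∀ b → ∣ sgn b * U n ∣ ≤ suc ⌊log₂ n ⌋
      unit b = ℕ.≤-trans (ℕ.≤-reflexive (trans (ℤ.abs-* (sgn b) (U n)) (trans (cong (ℕ._* ∣ U n ∣) (abs-sgn b)) (ℕ.*-identityˡ _))))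
                 (∣U∣≤log n)
        where
        abs-sgn : ∀ b → ∣ sgn b ∣ ≡ 1
        abs-sgn false = refl
        abs-sgn true  = refl
      drop-zero : ∀ n → ∑ (range 0 n) switch-cost ≤ ∑ (range 1 n) switch-cost
      drop-zero zero    = z≤n
      drop-zero (suc n) = ℕ.≤-trans (ℕ.≤-reflexive (cong (ℕ._+ ∑ (range 1 n) switch-cost) (ℕ.*-zeroʳ (change 0))))
        (ℕ.≤-trans (ℕ.m≤m+n _ _) (ℕ.≤-reflexive (sym (∑-range-suc 1 n switch-cost))))

    interior : ℕ → Bool
    interior n = not (σ n xor σ (suc n)) ∧ not (σ (suc n) xor σ (2 ℕ.+ n))

    S : NSet
    S zero      = false
    S n@(suc _) = not (u n xor σ n) ∧ interior n

    S-pos : ∀ {n} → 0 < n → S n ≡ not (u n xor σ n) ∧ interior n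
    S-pos {suc n} _ = refl

    S⇒ : ∀ n → S n ≡ true → u n ≡ σ n × σ n ≡ σ (1 ℕ.+ n) × σ (1 ℕ.+ n) ≡ σ (2 ℕ.+ n)
    S⇒ n@(suc _) e with u n xor σ n in e₁ | σ n xor σ (1 ℕ.+ n) in e₂ | σ (1 ℕ.+ n) xor σ (2 ℕ.+ n) in e₃
    ... | false | false | false = xor≡false⇒≡ e₁ , xor≡false⇒≡ e₂ , xor≡false⇒≡ e₃

    S-no-three : NoThreeConsecutive S
    S-no-three n (s₀ , s₁ , s₂) with S⇒ n s₀ | S⇒ (1 ℕ.+ n) s₁ | S⇒ (2 ℕ.+ n) s₂
    ... | a , b , c | d , _ | e , _ = not-both-equal n (trans a (trans b (sym d)) , trans d (trans c (sym e)))

    boundary : ℕ → ℕ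
    boundary n = change n ℕ.+ change (suc n)

    -- Twice the indicator of `S` minus 1 equals the sign uσ where σ is locally constant, and
    -- differs from it by at most 2 elsewhere.
    T-defect : ∀ n → ∣ (+ count S n * + 2 + -1ℤ * + n) - T n ∣ ≤ 2 ℕ.* ∑ (range 1 n) boundary
    T-defect zero    = z≤n
    T-defect (suc n) = begin
      ∣ (+ (𝟙 (S (suc n)) ℕ.+ count S n) * + 2 + -1ℤ * + suc n) - (T n + t) ∣
        ≡⟨ cong ∣_∣ (split (+ 𝟙 (S (suc n))) (+ count S n) (+ n) (T n) t) ⟩
      ∣ ((+ count S n * + 2 + -1ℤ * + n) - T n) + (+ 𝟙 (S (suc n)) * + 2 + -1ℤ - t) ∣
        ≤⟨ ℤ.∣i+j∣≤∣i∣+∣j∣ ((+ count S n * + 2 + -1ℤ * + n) - T n) _ ⟩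
      ∣ (+ count S n * + 2 + -1ℤ * + n) - T n ∣ ℕ.+ ∣ + 𝟙 (S (suc n)) * + 2 + -1ℤ - t ∣
        ≤⟨ ℕ.+-mono-≤ (T-defect n) (local (u (suc n) xor σ (suc n)) (σ (1 ℕ.+ n) xor σ (2 ℕ.+ n)) (σ (2 ℕ.+ n) xor σ (3 ℕ.+ n))) ⟩
      2 ℕ.* ∑ (range 1 n) boundary ℕ.+ 2 ℕ.* boundary (suc n)
        ≡⟨ ℕ.*-distribˡ-+ 2 (∑ (range 1 n) boundary) _ ⟨
      2 ℕ.* (∑ (range 1 n) boundary ℕ.+ boundary (suc n))
        ≡⟨ cong (2 ℕ.*_) (∑-range-suc 1 n boundary) ⟨
      2 ℕ.* ∑ (range 1 (suc n)) boundary ∎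
      where
      open ℕ.≤-Reasoning
      t = sgn (u (suc n) xor σ (suc n))
      split : ∀ d c m x t → ((d + c) * + 2 + -1ℤ * (1ℤ + m)) - (x + t) ≡
                            ((c * + 2 + -1ℤ * m) - x) + (d * + 2 + -1ℤ - t)
      split = solve-∀
      local : ∀ a b c → ∣ + 𝟙 (not a ∧ (not b ∧ not c)) * + 2 + -1ℤ - sgn a ∣ ≤ 2 ℕ.* (𝟙 b ℕ.+ 𝟙 c)
      local true  b     c     = z≤n
      local false true  c     = ℕ.*-monoʳ-≤ 2 {1} (s≤s z≤n)
      local false false true  = s≤s (s≤s z≤n)
      local false false false = z≤n

    S-density-½ : Null switch-cost → Null change → HasDensity S ½
    S-density-½ null-cost null-change = density S ½ bound
      where
      bound : ∀ K → ∃ λ N₀ → ∀ N → N₀ ≤ N → K ℕ.* deviation S ½ N ≤ N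
      -- The 5 is the total weight 2 + 1 + 2 of the three error terms in `total`.
      bound K with null-cost (5 ℕ.* K) | Null-+ null-change (Null-suc null-change) (5 ℕ.* K) | log-negligible (5 ℕ.* K)
      ... | N₁ , h₁ | N₂ , h₂ | N₃ , h₃ = N₁ ℕ.+ N₂ ℕ.+ N₃ , λ N le → ℕ.*-cancelˡ-≤ 5 (begin
          5 ℕ.* (K ℕ.* deviation S ½ N)
            ≤⟨ ℕ.*-monoʳ-≤ 5 (ℕ.*-monoʳ-≤ K (total N)) ⟩
          5 ℕ.* (K ℕ.* (2 ℕ.* D N ℕ.+ (L N ℕ.+ 2 ℕ.* F N)))
            ≡⟨ expand K (D N) (L N) (F N) ⟩
          2 ℕ.* (5 ℕ.* K ℕ.* D N) ℕ.+ (5 ℕ.* K ℕ.* L N ℕ.+ 2 ℕ.* (5 ℕ.* K ℕ.* F N))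
            ≤⟨ ℕ.+-mono-≤ (ℕ.*-monoʳ-≤ 2 (h₂ N (ℕ.≤-trans (ℕ.≤-trans (ℕ.m≤n+m N₂ N₁) (ℕ.m≤m+n _ N₃)) le)))
                 (ℕ.+-mono-≤ (h₃ N (ℕ.≤-trans (ℕ.m≤n+m N₃ _) le))
                   (ℕ.*-monoʳ-≤ 2 (h₁ N (ℕ.≤-trans (ℕ.≤-trans (ℕ.m≤m+n N₁ N₂) (ℕ.m≤m+n _ N₃)) le)))) ⟩
          2 ℕ.* N ℕ.+ (N ℕ.+ 2 ℕ.* N)
            ≡⟨ collect N ⟩
          5 ℕ.* N ∎)
        where
        open ℕ.≤-Reasoning
        D L F : ℕ → ℕ
        D N = ∑ (range 1 N) boundary
        L N = suc ⌊log₂ N ⌋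
        F N = ∑ (range 1 N) switch-cost
        expand : ∀ k d l f → 5 ℕ.* (k ℕ.* (2 ℕ.* d ℕ.+ (l ℕ.+ 2 ℕ.* f))) ≡
                             2 ℕ.* (5 ℕ.* k ℕ.* d) ℕ.+ (5 ℕ.* k ℕ.* l ℕ.+ 2 ℕ.* (5 ℕ.* k ℕ.* f))
        expand = ℕ-Solver.solve-∀
        collect : ∀ n → 2 ℕ.* n ℕ.+ (n ℕ.+ 2 ℕ.* n) ≡ 5 ℕ.* n
        collect = ℕ-Solver.solve-∀
        regroup : ∀ x t → x ≡ (x - t) + t
        regroup = solve-∀
        total : ∀ N → deviation S ½ N ≤ 2 ℕ.* D N ℕ.+ (L N ℕ.+ 2 ℕ.* F N)
        total N = ℕ.≤-trans (ℕ.≤-reflexive (cong ∣_∣ (regroup (+ count S N * + 2 + -1ℤ * + N) (T N))))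
          (ℕ.≤-trans (ℤ.∣i+j∣≤∣i∣+∣j∣ ((+ count S N * + 2 + -1ℤ * + N) - T N) (T N))
            (ℕ.+-mono-≤ (T-defect N) (∣T∣≤ N)))

    defect : ℕ → ℕ → ℕ
    defect p n = 𝟙 (σ (p ℕ.* n) xor (u p xor σ n))

    S-xor-bound : ∀ {p n} → 0 < p → 0 < n →
                  𝟙 (S n xor S (p ℕ.* n)) ≤ defect p n ℕ.+ (boundary n ℕ.+ boundary (p ℕ.* n))
    S-xor-bound {p} {n} p>0 n>0 = begin
      𝟙 (S n xor S (p ℕ.* n))
        ≡⟨ cong₂ (λ a b → 𝟙 (a xor b)) (S-pos n>0) (trans (S-pos (ℕ.*-mono-≤ p>0 n>0))
             (cong (λ b → not (b xor σ (p ℕ.* n)) ∧ interior (p ℕ.* n)) (u-* p n p>0 n>0))) ⟩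
      𝟙 ((x ∧ interior n) xor (y ∧ interior (p ℕ.* n)))
        ≤⟨ edge-bound x y (σ n xor σ (1 ℕ.+ n)) (σ (1 ℕ.+ n) xor σ (2 ℕ.+ n))
             (σ (p ℕ.* n) xor σ (1 ℕ.+ p ℕ.* n)) (σ (1 ℕ.+ p ℕ.* n) xor σ (2 ℕ.+ p ℕ.* n)) ⟩
      𝟙 (x xor y) ℕ.+ (boundary n ℕ.+ boundary (p ℕ.* n))
        ≡⟨ cong (λ b → 𝟙 b ℕ.+ (boundary n ℕ.+ boundary (p ℕ.* n))) (twist-bound (u n) (σ n) (u p) (σ (p ℕ.* n))) ⟩
      defect p n ℕ.+ (boundary n ℕ.+ boundary (p ℕ.* n)) ∎
      where
      open ℕ.≤-Reasoning
      x = not (u n xor σ n)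
      y = not ((u p xor u n) xor σ (p ℕ.* n))

    S-stable : Null change → (∀ {p} → Prime p → Null (defect p)) → Stable S
    S-stable null-change null-defect p p-prime = Null⇒density-0 _ (Null-mono (λ n n>0 → S-xor-bound p>0 n>0)
        (Null-+ (null-defect p-prime) (Null-+ null-boundary (Null-dilate p p>0 null-boundary))))
      where
      p>0 : 0 < p
      p>0 = ℕ.>-nonZero⁻¹ p {{prime⇒nonZero p-prime}}
      null-boundary : Null boundary
      null-boundary = Null-+ null-change (Null-suc null-change)

-- Gluing the stages along the dyadic blocks

module Gluing where

  open Arithmetic
  open Densities
  open import Data.Bool using (Bool; true; false; _xor_)
  open import Data.List using (length)
  open import Data.List.Membership.Propositional using (_∈_)
  open import Data.Nat
  open import Data.Nat.Logarithm
  open import Data.Nat.Primality using (Prime; prime⇒nonZero)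
  open import Data.Nat.Properties
  open import Data.Nat.Tactic.RingSolver using (solve-∀)
  open import Data.Product using (_,_; proj₁; proj₂)
  open import Relation.Binary.PropositionalEquality
  open import Relation.Nullary using (yes; no; contradiction)

  xor-self : ∀ b → b xor b ≡ false
  xor-self false = refl
  xor-self true  = refl

  ∑-telescope : ∀ (f : ℕ → ℕ) → (∀ {m n} → m ≤ n → f m ≤ f n) → ∀ a n →
                f a + ∑ (range a n) (λ x → f (suc x) ∸ f x) ≡ f (a + n)
  ∑-telescope f mono a zero    = trans (+-identityʳ (f a)) (cong f (sym (+-identityʳ a)))
  ∑-telescope f mono a (suc n) = begin
    f a + (f (suc a) ∸ f a + rest)    ≡⟨ +-assoc (f a) _ rest ⟨
    f a + (f (suc a) ∸ f a) + rest    ≡⟨ cong (_+ rest) (m+[n∸m]≡n (mono (n≤1+n a))) ⟩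
    f (suc a) + rest                  ≡⟨ ∑-telescope f mono (suc a) n ⟩
    f (suc a + n)                     ≡⟨ cong f (+-suc a n) ⟨
    f (a + suc n)                     ∎
    where
    open ≡-Reasoning
    rest = ∑ (range (suc a) n) (λ x → f (suc x) ∸ f x)

  m≤m*m : ∀ m → m ≤ m * m
  m≤m*m zero    = z≤n
  m≤m*m m@(suc _) = m≤m*n m m

  module Glue (st : ∀ K → Stage K) where

    module _ (K : ℕ) where
      open Stage (st K) public

    -- In state (k , θ) the tiles of stage k with label below θ already follow stage k + 1.
    -- Each dyadic block moves one more tile, so that consecutive blocks differ very little.
    State : Set
    State = ℕ × ℕ

    -- A level is entered only when its period and the next one, which are in use together there,
    -- add up to at most the index `suc s` of the new block. This keeps the number of sign changes
    -- in a block linear in its index.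
    step : ℕ → State → State
    step s (k , θ) with θ <? period k
    ... | yes _ = k , suc θ
    ... | no _ with period (1 + k) + period (2 + k) ≤? suc s
    ...   | yes _ = suc k , 0
    ...   | no _  = k , θ

    state : ℕ → State
    state zero    = 0 , 0
    state (suc s) = step s (state s)

    level phase : ℕ → ℕ
    level s = proj₁ (state s)
    phase s = proj₂ (state s)

    mix : State → ℕ → Bool
    mix (k , θ) n with label k n <? θ
    ... | yes _ = sign (suc k) n
    ... | no _  = sign k n

    σ : ℕ → Bool
    σ n = mix (state ⌊log₂ n ⌋) n

    open Twisted σ

    -- Raising `θ` affects only the label `θ`. When the level rises, all labels of stage `k` are
    -- already below `θ`, so the old mixture is stage `suc k` throughout, and so is the new one at
    -- phase 0.
    mix-step : ∀ s w n → label (proj₁ w) n ≢ proj₂ w → mix (step s w) n ≡ mix w n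
    mix-step s (k , θ) n l≢θ with θ <? period k
    ... | yes _ with label k n <? θ | label k n <? suc θ
    ...   | yes _   | yes _   = refl
    ...   | yes l<θ | no l≮   = contradiction (m<n⇒m<1+n l<θ) l≮
    ...   | no l≮θ  | yes l<  = contradiction (≤∧≢⇒< (≤-pred l<) l≢θ) l≮θ
    ...   | no _    | no _    = refl
    mix-step s (k , θ) n l≢θ | no θ≮ with period (1 + k) + period (2 + k) ≤? suc s
    ...   | no _ = refl
    ...   | yes _ with label k n <? θ | label (suc k) n <? 0
    ...     | no l≮θ | _ = contradiction (<-≤-trans (label<period k n) (≮⇒≥ θ≮)) l≮θ
    ...     | yes _  | no _ = refl

    -- The initial state has passed no test of its periods; this constant makes the bound on them
    -- hold from block 0 on.
    slack : ℕ
    slack = period 0 + period 1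

    step-ready : ∀ s w → period (proj₁ w) + period (suc (proj₁ w)) ≤ s + slack →
      period (proj₁ (step s w)) + period (suc (proj₁ (step s w))) ≤ suc s + slack
    step-ready s (k , θ) ready with θ <? period k
    ... | yes _ = m≤n⇒m≤1+n ready
    ... | no _ with period (1 + k) + period (2 + k) ≤? suc s
    ...   | yes r = ≤-trans r (m≤m+n (suc s) slack)
    ...   | no _  = m≤n⇒m≤1+n ready

    periods-small : ∀ s → period (level s) + period (suc (level s)) ≤ s + slack
    periods-small zero    = ≤-refl
    periods-small (suc s) = step-ready s (state s) (periods-small s)

    step-mono : ∀ s w → proj₁ w ≤ proj₁ (step s w)
    step-mono s (k , θ) with θ <? period k
    ... | yes _ = ≤-refl
    ... | no _ with period (1 + k) + period (2 + k) ≤? suc s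
    ...   | yes _ = n≤1+n k
    ...   | no _  = ≤-refl

    level-mono : ∀ s i → level s ≤ level (i + s)
    level-mono s zero    = ≤-refl
    level-mono s (suc i) = ≤-trans (level-mono s i) (step-mono (i + s) (state (i + s)))

    -- The fuel bounds the phases still to pass plus the blocks still to wait for the next periods
    -- to be admissible; every step that stays at level `k` lowers this sum.
    advance : ∀ fuel s k θ → state s ≡ (k , θ) →
      (period k ∸ θ) + (period (1 + k) + period (2 + k) ∸ s) ≤ fuel → ∃ λ s′ → suc k ≤ level s′
    advance fuel s k θ eq le with θ <? period k in e₁
    ... | yes θ< = next fuel le
      where
      eq′ : state (suc s) ≡ (k , suc θ)
      eq′ rewrite eq | e₁ = refl
      shrink : suc ((period k ∸ suc θ) + (period (1 + k) + period (2 + k) ∸ suc s)) ≤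
               (period k ∸ θ) + (period (1 + k) + period (2 + k) ∸ s)
      shrink = +-mono-≤ (≤-reflexive (sym (+-∸-assoc 1 θ<))) (∸-monoʳ-≤ (period (1 + k) + period (2 + k)) (n≤1+n s))
      next : ∀ fuel → (period k ∸ θ) + (period (1 + k) + period (2 + k) ∸ s) ≤ fuel → ∃ λ s′ → suc k ≤ level s′
      next zero       le = contradiction (≤-trans shrink le) λ ()
      next (suc fuel) le = advance fuel (suc s) k (suc θ) eq′ (≤-pred (≤-trans shrink le))
    ... | no _ with period (1 + k) + period (2 + k) ≤? suc s in e₂
    ...   | yes _ = suc s , ≤-reflexive (sym (cong proj₁ eq′))
      where
      eq′ : state (suc s) ≡ (suc k , 0)
      eq′ rewrite eq | e₁ | e₂ = refl
    ...   | no r = next fuel le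
      where
      eq′ : state (suc s) ≡ (k , θ)
      eq′ rewrite eq | e₁ | e₂ = refl
      shrink : suc ((period k ∸ θ) + (period (1 + k) + period (2 + k) ∸ suc s)) ≤
               (period k ∸ θ) + (period (1 + k) + period (2 + k) ∸ s)
      shrink = ≤-trans (≤-reflexive (sym (+-suc (period k ∸ θ) _)))
        (+-monoʳ-≤ (period k ∸ θ) (≤-reflexive (sym (+-∸-assoc 1 (<⇒≤ (≰⇒> r))))))
      next : ∀ fuel → (period k ∸ θ) + (period (1 + k) + period (2 + k) ∸ s) ≤ fuel → ∃ λ s′ → suc k ≤ level s′
      next zero       le = contradiction (≤-trans shrink le) λ ()
      next (suc fuel) le = advance fuel (suc s) k θ eq′ (≤-pred (≤-trans shrink le))

    level-reaches : ∀ K → ∃ λ s → K ≤ level s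
    level-reaches zero    = 0 , z≤n
    level-reaches (suc K) with level-reaches K
    ... | s , K≤ with advance _ s (level s) (phase s) refl ≤-refl
    ...   | s′ , lt = s′ , ≤-trans (s≤s K≤) lt

    level-unbounded : ∀ K → ∃ λ s₀ → ∀ s → s₀ ≤ s → K ≤ level s
    level-unbounded K with level-reaches K
    ... | s₀ , K≤ = s₀ , λ s s₀≤s → ≤-trans K≤ (subst (λ t → level s₀ ≤ level t) (m∸n+n≡m s₀≤s) (level-mono s₀ (s ∸ s₀)))

    log-block : ∀ {s n} → n ∈ block s → ⌊log₂ n ⌋ ≡ s
    log-block {s} m = let lo , hi = ∈-block⁻ {s} m in ⌊log₂⌋-unique lo hi

    block-pos : ∀ {s n} → n ∈ block s → 0 < n
    block-pos {s} m = ≤-trans (^>0 2 s (s≤s z≤n)) (proj₁ (∈-block⁻ {s} m))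

    -- The number of cell boundaries of stage `k` between `n` and `suc n`.
    jump : ℕ → ℕ → ℕ
    jump k n = index k (suc n) ∸ index k n

    jump-total : ∀ k s → ∑ (block s) (jump k) ≡ period k
    jump-total k s = +-cancelˡ-≡ (index k (2 ^ s)) _ _ (begin
      index k (2 ^ s) + ∑ (block s) (jump k)   ≡⟨ ∑-telescope (index k) (index-mono k) (2 ^ s) (2 ^ s) ⟩
      index k (2 ^ s + 2 ^ s)                  ≡⟨ cong (λ z → index k (2 ^ s + z)) (+-identityʳ (2 ^ s)) ⟨
      index k (2 ^ suc s)                      ≡⟨ index-block k s ⟩
      period k + index k (2 ^ s)               ≡⟨ +-comm (period k) _ ⟩
      index k (2 ^ s) + period k               ∎)
      where open ≡-Reasoning

    jump≡0 : ∀ k n → jump k n ≡ 0 → index k n ≡ index k (suc n)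
    jump≡0 k n eq = ≤-antisym (index-mono k (n≤1+n n)) (m∸n≡0⇒m≤n eq)

    mix-index : ∀ k θ {m n} → index k m ≡ index k n → index (suc k) m ≡ index (suc k) n →
                mix (k , θ) m ≡ mix (k , θ) n
    mix-index k θ {m} {n} e e′ with label k m <? θ | label k n <? θ
    ... | yes _  | yes _  = sign-index (suc k) e′
    ... | yes lt | no ≮   = contradiction (subst (_< θ) (label-index k e) lt) ≮
    ... | no ≮   | yes lt = contradiction (subst (_< θ) (sym (label-index k e)) lt) ≮
    ... | no _   | no _   = sign-index k e

    -- Inside a block the state is fixed, so the sign can change only where one of the two indices
    -- does. The last term pays for the end of the block, where the state may change.
    change-bound : ∀ s {n} → n ∈ block s →
      change n ≤ jump (level s) n + jump (suc (level s)) n + δ (suc n) (2 ^ suc s)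
    change-bound s {n} m with jump (level s) n + jump (suc (level s)) n + δ (suc n) (2 ^ suc s) in eq
    ... | suc _ = ≤-trans (𝟙≤1 _) (s≤s z≤n)
    ... | zero  = ≤-reflexive (cong 𝟙 (trans (cong (_xor σ (suc n)) same) (xor-self (σ (suc n)))))
      where
      k = level s
      jumps : jump k n + jump (suc k) n ≡ 0
      jumps = m+n≡0⇒m≡0 _ eq
      ≢top : suc n ≢ 2 ^ suc s
      ≢top e = contradiction (trans (sym (δ-refl (2 ^ suc s))) (trans (cong (λ z → δ z (2 ^ suc s)) (sym e))
                 (m+n≡0⇒n≡0 (jump k n + jump (suc k) n) eq))) λ ()
      log-suc : ⌊log₂ suc n ⌋ ≡ s
      log-suc = let lo , hi = ∈-block⁻ {s} m in ⌊log₂⌋-unique (m≤n⇒m≤1+n lo) (≤∧≢⇒< hi ≢top)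
      same : σ n ≡ σ (suc n)
      same = begin
        mix (state ⌊log₂ n ⌋) n            ≡⟨ cong (λ t → mix (state t) n) (log-block {s} m) ⟩
        mix (state s) n                    ≡⟨ mix-index k (phase s) (jump≡0 k n (m+n≡0⇒m≡0 _ jumps))
                                                (jump≡0 (suc k) n (m+n≡0⇒n≡0 (jump k n) jumps)) ⟩
        mix (state s) (suc n)              ≡⟨ cong (λ t → mix (state t) (suc n)) log-suc ⟨
        mix (state ⌊log₂ suc n ⌋) (suc n)  ∎
        where open ≡-Reasoning

    block-changes : ∀ s → ∑ (block s) change ≤ s + suc slack
    block-changes s = begin
      ∑ (block s) change
        ≤⟨ ∑-mono (block s) (λ n m → change-bound s m) ⟩
      ∑ (block s) (λ n → jump k n + jump (suc k) n + δ (suc n) (2 ^ suc s))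
        ≡⟨ trans (∑-distrib-+ (block s) _ _) (cong (_+ ∑ (block s) (λ n → δ (suc n) (2 ^ suc s))) (∑-distrib-+ (block s) _ _)) ⟩
      ∑ (block s) (jump k) + ∑ (block s) (jump (suc k)) + ∑ (block s) (λ n → δ (suc n) (2 ^ suc s))
        ≤⟨ +-mono-≤ (≤-reflexive (cong₂ _+_ (jump-total k s) (jump-total (suc k) s)))
             (∑-unique (range-unique (2 ^ s) (2 ^ s)) (λ n → δ≤1 (suc n) (2 ^ suc s))
               (λ _ _ p q → suc-injective (trans (δ>0 p) (sym (δ>0 q))))) ⟩
      period k + period (suc k) + 1
        ≤⟨ +-monoˡ-≤ 1 (periods-small s) ⟩
      s + slack + 1
        ≡⟨ trans (+-comm (s + slack) 1) (sym (+-suc s slack)) ⟩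
      s + suc slack ∎
      where
      open ≤-Reasoning
      k = level s

    null-change : Null change
    null-change = Null-blocks λ K → let s₀ , h = shifted-square≤2^ K (suc slack) in s₀ , λ s le →
      ≤-trans (*-monoʳ-≤ K (≤-trans (block-changes s) (m≤m*m (s + suc slack)))) (h s le)

    null-switch-cost : Null switch-cost
    null-switch-cost = Null-blocks λ K → let s₀ , h = shifted-square≤2^ K (suc slack) in s₀ , λ s le →
      ≤-trans (*-monoʳ-≤ K (bound s)) (h s le)
      where
      bound : ∀ s → ∑ (block s) switch-cost ≤ (s + suc slack) * (s + suc slack)
      bound s = begin
        ∑ (block s) switch-cost
          ≤⟨ ∑-mono (block s) (λ n m → *-monoʳ-≤ (change n) (∣U∣≤ (suc s) n (proj₂ (∈-block⁻ {s} m)))) ⟩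
        ∑ (block s) (λ n → change n * suc s)
          ≡⟨ ∑-*ʳ (block s) (suc s) change ⟩
        ∑ (block s) change * suc s
          ≤⟨ *-mono-≤ (block-changes s) (≤-trans (m≤m+n (suc s) slack) (≤-reflexive (sym (+-suc s slack)))) ⟩
        (s + suc slack) * (s + suc slack) ∎
        where open ≤-Reasoning

    -- The label is invariant, so `n` and `p * n` take their signs from the same one of the two
    -- stages.
    mix-equivariant : ∀ {p n} k θ → Prime p → p ≤ k → 0 < n → bad k n ≡ 0 → bad (suc k) n ≡ 0 →
                      mix (k , θ) (p * n) ≡ u p xor mix (k , θ) n
    mix-equivariant {p} {n} k θ pr p≤k n>0 b b′ with label k (p * n) <? θ | label k n <? θ
    ... | yes _  | yes _  = sign-equivariant (suc k) pr (m≤n⇒m≤1+n p≤k) n>0 b′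
    ... | yes lt | no ≮   = contradiction (subst (_< θ) (label-invariant k pr p≤k n>0 b) lt) ≮
    ... | no ≮   | yes lt = contradiction (subst (_< θ) (sym (label-invariant k pr p≤k n>0 b)) lt) ≮
    ... | no _   | no _   = sign-equivariant k pr p≤k n>0 b

    -- Flags `n` in the tile that is exchanged after block `s`, or bad for one of the two stages in
    -- use.
    obstacle : ℕ → ℕ → ℕ
    obstacle s n = δ (label (level s) n) (phase s) + (bad (level s) n + bad (suc (level s)) n)

    obstacles : ℕ → ℕ → ℕ → ℕ
    obstacles p s n = ∑ (range 0 (suc p)) (λ r → obstacle (r + s) n)

    mix-steady : ∀ s n r → (∀ i → i < r → obstacle (i + s) n ≡ 0) → mix (state (r + s)) n ≡ mix (state s) n
    mix-steady s n zero    h = refl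
    mix-steady s n (suc r) h = trans (mix-step (r + s) (state (r + s)) n label≢phase)
      (mix-steady s n r (λ i i<r → h i (m<n⇒m<1+n i<r)))
      where
      label≢phase : label (level (r + s)) n ≢ phase (r + s)
      label≢phase e = contradiction (trans (sym (δ-refl (phase (r + s)))) (trans (cong (λ z → δ z (phase (r + s))) (sym e))
        (m+n≡0⇒m≡0 _ (h r ≤-refl)))) λ ()

    -- The product `p * n` lies `r ≤ p` blocks after `n`. Equivariance is applied in the state of
    -- that later block, and the sign of `n` is carried back to its own block through the states in
    -- between.
    defect-bound : ∀ {p} → Prime p → ∀ s → p ≤ level s → ∀ {n} → n ∈ block s → defect p n ≤ obstacles p s n
    defect-bound {p} pr s p≤ {n} m with obstacles p s n in eq
    ... | suc _ = ≤-trans (𝟙≤1 _) (s≤s z≤n)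
    ... | zero  = ≤-reflexive (cong 𝟙 (trans (cong (_xor (u p xor σ n)) same) (xor-self (u p xor σ n))))
      where
      n>0 : 0 < n
      n>0 = block-pos {s} m
      p>0 : 0 < p
      p>0 = >-nonZero⁻¹ p {{prime⇒nonZero pr}}
      s≤ : s ≤ ⌊log₂ (p * n) ⌋
      s≤ = 2^k≤n⇒k≤⌊log₂n⌋ (≤-trans (proj₁ (∈-block⁻ {s} m)) (m≤n*m n p {{>-nonZero p>0}}))
      r : ℕ
      r = ⌊log₂ (p * n) ⌋ ∸ s
      r+s : r + s ≡ ⌊log₂ (p * n) ⌋
      r+s = m∸n+n≡m s≤
      r≤p : r ≤ p
      r≤p = ≤-trans (∸-monoˡ-≤ s (≤-pred (n<2^k⇒⌊log₂n⌋<k {suc (p + s)} (*-mono-≤ p>0 n>0) (begin-strict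
          p * n                <⟨ *-mono-< (n<2^n p) (proj₂ (∈-block⁻ {s} m)) ⟩
          2 ^ p * 2 ^ suc s    ≡⟨ ^-distribˡ-+-* 2 p (suc s) ⟨
          2 ^ (p + suc s)      ≡⟨ cong (2 ^_) (+-suc p s) ⟩
          2 ^ suc (p + s)      ∎)))) (≤-reflexive (m+n∸n≡m p s))
        where open ≤-Reasoning
      clear : ∀ i → i ≤ p → obstacle (i + s) n ≡ 0
      clear i i≤p = ∑≡0 (range 0 (suc p)) (λ r → obstacle (r + s) n) eq (∈-range⁺ z≤n (s≤s i≤p))
      bads : bad (level (r + s)) n + bad (suc (level (r + s))) n ≡ 0
      bads = m+n≡0⇒n≡0 (δ (label (level (r + s)) n) (phase (r + s))) (clear r r≤p)
      same : σ (p * n) ≡ u p xor σ n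
      same = begin
        mix (state ⌊log₂ (p * n) ⌋) (p * n)   ≡⟨ cong (λ t → mix (state t) (p * n)) r+s ⟨
        mix (state (r + s)) (p * n)           ≡⟨ mix-equivariant (level (r + s)) (phase (r + s)) pr
                                                   (≤-trans p≤ (level-mono s r)) n>0
                                                   (m+n≡0⇒m≡0 _ bads) (m+n≡0⇒n≡0 (bad (level (r + s)) n) bads) ⟩
        u p xor mix (state (r + s)) n         ≡⟨ cong (u p xor_) (mix-steady s n r (λ i i<r → clear i (≤-trans (<⇒≤ i<r) r≤p))) ⟩
        u p xor mix (state s) n               ≡⟨ cong (λ t → u p xor mix (state t) n) (log-block {s} m) ⟨
        u p xor σ n                           ∎
        where open ≡-Reasoning

    -- Three kinds of obstacles, each rare by the properties of the stages. The state may be that of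
    -- a later block than the one summed over, whence the separate hypothesis on the periods.
    obstacle-rare : ∀ K s t → K ≤ level t → period (level t) + period (suc (level t)) ≤ 2 ^ s →
                    K * ∑ (block s) (obstacle t) ≤ 3 * 2 ^ s
    obstacle-rare K s t K≤ small = begin
      K * ∑ (block s) (obstacle t)
        ≡⟨ cong (K *_) (trans (∑-distrib-+ (block s) _ _) (cong (∑ (block s) labels +_) (∑-distrib-+ (block s) _ _))) ⟩
      K * (∑ (block s) labels + (∑ (block s) (bad k) + ∑ (block s) (bad (suc k))))
        ≡⟨ distribute K _ _ _ ⟩
      K * ∑ (block s) labels + (K * ∑ (block s) (bad k) + K * ∑ (block s) (bad (suc k)))
        ≤⟨ +-mono-≤ (≤-trans (*-monoˡ-≤ _ (m≤n⇒m≤1+n K≤)) (label-rare k s (phase t) small₁))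
             (+-mono-≤ (≤-trans (*-monoˡ-≤ _ (m≤n⇒m≤1+n K≤)) (bad-rare k s small₁))
                       (≤-trans (*-monoˡ-≤ _ (m≤n⇒m≤1+n (m≤n⇒m≤1+n K≤))) (bad-rare (suc k) s small₂))) ⟩
      2 ^ s + (2 ^ s + 2 ^ s)
        ≡⟨ three (2 ^ s) ⟩
      3 * 2 ^ s ∎
      where
      open ≤-Reasoning
      k = level t
      labels : ℕ → ℕ
      labels n = δ (label k n) (phase t)
      small₁ : period k ≤ 2 ^ s
      small₁ = ≤-trans (m≤m+n _ _) small
      small₂ : period (suc k) ≤ 2 ^ s
      small₂ = ≤-trans (m≤n+m _ (period k)) small
      distribute : ∀ k a b c → k * (a + (b + c)) ≡ k * a + (k * b + k * c)
      distribute = solve-∀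
      three : ∀ x → x + (x + x) ≡ 3 * x
      three = solve-∀

    null-defect : ∀ {p} → Prime p → Null (defect p)
    null-defect {p} pr = Null-blocks rare
      where
      rare : ∀ K → ∃ λ s₀ → ∀ s → s₀ ≤ s → K * ∑ (block s) (defect p) ≤ 2 ^ s
      -- The summand `p` of the level admits the prime, and `3 * suc p * K` pays for three kinds of
      -- obstacles in each of `suc p` states. The other bound keeps the periods of all these states
      -- below the length of the block of `n`.
      rare K with level-unbounded (p + 3 * suc p * K) | shifted-square≤2^ 1 (p + slack)
      ... | s₁ , high | s₂ , small = s₁ + s₂ , λ s le → *-cancelˡ-≤ (3 * suc p) (bound s
              (λ i → high (i + s) (≤-trans (≤-trans (m≤m+n s₁ s₂) le) (m≤n+m s i)))
              (≤-trans (m≤m*m (s + (p + slack))) (≤-trans (≤-reflexive (sym (*-identityˡ _))) (small s (≤-trans (m≤n+m s₂ s₁) le)))))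
        where
        open ≤-Reasoning
        bound : ∀ s → (∀ i → p + 3 * suc p * K ≤ level (i + s)) → s + (p + slack) ≤ 2 ^ s →
                3 * suc p * (K * ∑ (block s) (defect p)) ≤ 3 * suc p * 2 ^ s
        bound s high-levels periods≤ = begin
          c * (K * ∑ (block s) (defect p))
            ≡⟨ *-assoc c K _ ⟨
          c * K * ∑ (block s) (defect p)
            ≤⟨ *-monoʳ-≤ (c * K) (∑-mono (block s) (λ n m → defect-bound pr s (≤-trans (m≤m+n p _) (high-levels 0)) m)) ⟩
          c * K * ∑ (block s) (obstacles p s)
            ≡⟨ cong (c * K *_) (∑-swap (block s) (range 0 (suc p)) _) ⟩
          c * K * ∑ (range 0 (suc p)) (λ r → ∑ (block s) (obstacle (r + s)))
            ≡⟨ ∑-*ˡ (range 0 (suc p)) (c * K) _ ⟨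
          ∑ (range 0 (suc p)) (λ r → c * K * ∑ (block s) (obstacle (r + s)))
            ≤⟨ ∑-bound (range 0 (suc p)) (3 * 2 ^ s) (λ r m → obstacle-rare (c * K) s (r + s)
                 (≤-trans (m≤n+m (c * K) p) (high-levels r)) (periods r (≤-pred (proj₂ (∈-range⁻ m))))) ⟩
          length (range 0 (suc p)) * (3 * 2 ^ s)
            ≡⟨ cong (_* (3 * 2 ^ s)) (length-range 0 (suc p)) ⟩
          suc p * (3 * 2 ^ s)
            ≡⟨ regroup (suc p) (2 ^ s) ⟩
          c * 2 ^ s ∎
          where
          c = 3 * suc p
          regroup : ∀ q x → q * (3 * x) ≡ 3 * q * x
          regroup = solve-∀
          shuffle : ∀ r s w → r + s + w ≡ s + (r + w)
          shuffle = solve-∀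
          periods : ∀ r → r ≤ p → period (level (r + s)) + period (suc (level (r + s))) ≤ 2 ^ s
          periods r r≤p = ≤-trans (periods-small (r + s)) (≤-trans (≤-reflexive (shuffle r s slack))
            (≤-trans (+-monoʳ-≤ s (+-monoˡ-≤ slack r≤p)) periods≤))

    main : ∃ λ (S : NSet) → S 0 ≡ false × Stable S × HasDensity S ½ × NoThreeConsecutive S
    main = S , refl , S-stable null-change null-defect , S-density-½ null-switch-cost null-change , S-no-three

theorem1p6 : ∃ λ (S : NSet) →
    S 0 ≡ false × Stable S × HasDensity S ½ × NoThreeConsecutive S
theorem1p6 = Gluing.Glue.main Arithmetic.stages
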